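{- For every $q=q(n)$ with $q\le O(n^2)$, $$L(n,q)\asymp \frac{n2^n}{\log_2 n},$$ i.e. there are constants $0<c_1\le c_2$ such that $c_1\frac{n2^n}{\log_2 n}\le L(n,q)\le c_2\frac{n2^n}{\log_2 n}$ for all sufficiently large $n$.
   Context: For $m\ge 1$, a $k$-CNOT gate on $m$ lines, with distinct control indices $i_1,\dots,i_k$ and a target index $j\notin\{i_1,\dots,i_k\}$, is the map $\mathbb{Z}_2^m\to\mathbb{Z}_2^m$, $\langle x_1,\dots,x_m\rangle\mapsto\langle x_1,\dots,x_j\oplus x_{i_1}\wedge\dots\wedge x_{i_k},\dots,x_m\rangle$. NOT, CNOT and 2-CNOT are the cases $k=0,1,2$. A reversible circuit on $m$ lines is a finite sequence of such gates; it computes the composition $g$ of its gates, and its complexity is its number of gates. A circuit with $n+q$ lines implements $f\colon\mathbb{Z}_2^n\to\mathbb{Z}_2^n$ with $q$ additional inputs if $\psi_{n+q,n}(g(\phi_{n,n+q}(\mathbf x)))=f(\mathbf x)$ for all $\mathbf x\in\mathbb{Z}_2^n$, where $\phi_{n,n+q}$ appends $q$ zero coordinates and $\psi_{n+q,n}$ keeps the first $n$ coordinates. Let $F(n,q)$ be the set of maps $\mathbb{Z}_2^n\to\mathbb{Z}_2^n$ that can be implemented by such a circuit of NOT, CNOT and 2-CNOT gates with $n+q$ inputs. The Shannon function $L(n,q)$ is the maximum, over all $f\in F(n,q)$, of the minimum complexity of a reversible circuit of NOT, CNOT and 2-CNOT gates implementing $f$ with $q$ additional inputs. -}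

module Defs where

open import Data.Nat using (ℕ; zero; suc; _+_; _*_; _^_; _≤_; _<_)
open import Data.Bool using (Bool; true; false; _xor_; _∧_)
open import Data.Fin using (Fin)
open import Data.Vec using (Vec; lookup; updateAt; replicate; take; _++_)
open import Data.List using (List; []; _∷_; length; foldr)
open import Data.List.Relation.Unary.Unique.Propositional using (Unique)
open import Data.List.Membership.Propositional using (_∉_)
open import Data.Product using (Σ; _×_; ∃)
open import Relation.Binary.PropositionalEquality using (_≡_)
open import Relation.Nullary using (¬_)

Bits : ℕ → Set
Bits m = Vec Bool m

-- A k-CNOT gate on m lines with k ≤ 2 (i.e. a NOT, CNOT or 2-CNOT gate):
-- a list of pairwise distinct control indices, of length k ≤ 2,
-- and a target index not among the controls.
record Gate (m : ℕ) : Set where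
  constructor gate
  field
    controls   : List (Fin m)
    target     : Fin m
    distinct   : Unique controls
    targetFree : target ∉ controls
    arity≤2    : length controls ≤ 2

-- conjunction of the control bits (empty conjunction = true, giving NOT)
conj : ∀ {m} → List (Fin m) → Bits m → Bool
conj []       x = true
conj (i ∷ is) x = lookup x i ∧ conj is x

applyGate : ∀ {m} → Gate m → Bits m → Bits m
applyGate g x = updateAt x (Gate.target g) (λ b → b xor conj (Gate.controls g) x)

Circuit : ℕ → Set
Circuit m = List (Gate m)

evalCircuit : ∀ {m} → Circuit m → Bits m → Bits m
evalCircuit []       x = x
evalCircuit (g ∷ gs) x = evalCircuit gs (applyGate g x)

complexity : ∀ {m} → Circuit m → ℕ
complexity = length

φ : (n q : ℕ) → Bits n → Bits (n + q)
φ n q x = x ++ replicate q false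

ψ : (n q : ℕ) → Bits (n + q) → Bits n
ψ n q y = take n y

Implements : (n q : ℕ) → Circuit (n + q) → (Bits n → Bits n) → Set
Implements n q c f = ∀ (x : Bits n) → ψ n q (evalCircuit c (φ n q x)) ≡ f x

InF : (n q : ℕ) → (Bits n → Bits n) → Set
InF n q f = Σ (Circuit (n + q)) λ c → Implements n q c f

-- L is the value of the Shannon function L(n,q):
-- every f ∈ F(n,q) has an implementing circuit of complexity ≤ L, and
-- some f ∈ F(n,q) has no implementing circuit of complexity < L.
-- (Equivalently, L = max_{f ∈ F(n,q)} min { complexity c | c implements f }.)
IsShannon : (n q : ℕ) → ℕ → Set
IsShannon n q L =
  (∀ (f : Bits n → Bits n) → InF n q f →
     Σ (Circuit (n + q)) λ c → Implements n q c f × complexity c ≤ L)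
  × (Σ (Bits n → Bits n) λ f → InF n q f ×
       (∀ (c : Circuit (n + q)) → Implements n q c f → ¬ (complexity c < L)))

IsOn² : (ℕ → ℕ) → Set
IsOn² q = Σ ℕ λ C → Σ ℕ λ N → ∀ n → N ≤ n → q n ≤ C * (n * n)

-- (a/b) · n2^n / log₂ n ≤ L, for n ≥ 2, written without reals:
-- equivalent to a·n·2^n ≤ b·L·log₂ n, i.e. 2^(a·n·2^n) ≤ n^(b·L).
LowerBound : (a b n L : ℕ) → Set
LowerBound a b n L = 2 ^ (a * (n * 2 ^ n)) ≤ n ^ (b * L)

-- L ≤ (a/b) · n2^n / log₂ n, for n ≥ 2: equivalent to n^(b·L) ≤ 2^(a·n·2^n).
UpperBound : (a b n L : ℕ) → Set
UpperBound a b n L = n ^ (b * L) ≤ 2 ^ (a * (n * 2 ^ n))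

{-# OPTIONS --safe #-}

-- Lower bound: composing exchanges of points (0,0,i) and (1,0,t i), each paired with the exchange of
-- (0,1,i) and (1,1,t i), gives (2^k)^(2^k) distinct maps in F(n,q) for k = n - 2, while there are at
-- most n^(9L) circuits of complexity at most L.
--
-- Upper bound: the required injection Z₂ⁿ → Z₂ᵐ (m ≤ 2n) is built by multiplying with products of
-- K = 2^j disjoint transpositions, each settling K more inputs. The 2K points involved form a matrix
-- with 2K rows, hence with at most 2^(2K) distinct columns; for 2K between (log₂ n)/8 and (log₂ n)/4, this is so few that
-- O(n) gates suffice for all K transpositions together, giving O(2^n / K) · O(n) = O(n 2^n / log₂ n)
-- gates in total. Fewer than 3K inputs remain; they are settled by pairs of transpositions, and parity
-- (for q = 0) or a spare line (for q > 0) takes care of a single transposition left at the end.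

module Submission where

open import Defs
open import Data.Nat using (ℕ; zero; suc; _+_; _*_; _^_; _∸_; _≤_; _<_; z≤n; s≤s; s≤s⁻¹; ⌊_/2⌋; ⌈_/2⌉)
open import Data.Nat.Properties
open import Data.Nat.Tactic.RingSolver using (solve-∀)
open import Data.Bool using (Bool; true; false; not; _xor_; _∧_; if_then_else_)
import Data.Bool as B
open import Data.Bool.Properties using (∧-assoc; xor-assoc; xor-comm; xor-same; xor-identityʳ; ∧-comm)
open import Data.Fin using (Fin; zero; suc; combine; remQuot; finToFun; funToFin)
import Data.Fin as F
import Data.Fin.Properties as FP
open import Data.Vec using (Vec; []; _∷_)
import Data.Vec as V
import Data.List
import Data.Vec.Properties as VP
open import Data.List using (List; []; _∷_; length; map; filter; _++_; take; drop; allFin; mapMaybe; cartesianProduct; cartesianProductWith)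
open import Data.List.Properties using (length-++; length-map; length-tabulate; take++drop≡id; length-take; length-drop; map-cong; map-∘; length-filter; filter-all; length-mapMaybe; map-id; map-id-local)
open import Data.List.Relation.Unary.Any using (Any; here; there; any?)
open import Data.List.Relation.Unary.All using (All; []; _∷_)
import Data.List.Relation.Unary.All as All
import Data.List.Relation.Unary.All.Properties as AllP
open import Data.List.Relation.Unary.AllPairs using ([]; _∷_)
open import Data.List.Relation.Unary.Unique.Propositional using (Unique)
import Data.List.Relation.Unary.Unique.Propositional.Properties as UP
open import Data.List.Membership.Propositional using (_∈_; _∉_)
open import Data.List.Membership.Propositional.Properties
open import Data.List.Relation.Binary.Permutation.Propositional using (_↭_; prep; swap; ↭-trans)
import Data.List.Relation.Binary.Permutation.Propositional as Perm
open import Data.List.Relation.Binary.BagAndSetEquality using (∼bag⇒↭)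
open import Data.List.Membership.Propositional.Properties.WithK using (unique∧set⇒bag)
import Data.List.Relation.Binary.Permutation.Propositional.Properties as PermP
import Data.List.Relation.Binary.Permutation.Setoid.Properties as PermS
open import Data.Product using (Σ; ∃; _×_; _,_; proj₁; proj₂)
open import Data.Sum using (_⊎_; inj₁; inj₂)
import Data.Sum as Sum
import Data.Sum.Properties as SumP
open import Data.Empty using (⊥; ⊥-elim)
open import Data.Maybe using (Maybe; just; nothing)
import Data.Maybe.Relation.Unary.Any as MAny
import Data.List.Relation.Unary.Any as Any
import Data.List.Relation.Unary.Any.Properties as AnyP
import Data.List.Relation.Unary.Unique.DecPropositional as UniqueDec
open import Function using (_∘_; id; mk⇔)
open import Relation.Binary.PropositionalEquality
open import Relation.Binary using (DecidableEquality)
open import Relation.Nullary using (¬_; Dec; yes; no)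
open import Relation.Nullary.Decidable using (map′; ¬?; _→-dec_; _⊎-dec_; decidable-stable)

-- Bit vectors and circuits

_≟ᵇ_ : ∀ {n} → DecidableEquality (Bits n)
_≟ᵇ_ = VP.≡-dec B._≟_

lookup-ext : ∀ {m} {x y : Bits m} → (∀ i → V.lookup x i ≡ V.lookup y i) → x ≡ y
lookup-ext {x = x} {y} eq =
  trans (sym (VP.tabulate∘lookup x)) (trans (VP.tabulate-cong eq) (VP.tabulate∘lookup y))

bit→Fin : Bool → Fin 2
bit→Fin false = zero
bit→Fin true  = suc zero

Fin→bit : Fin 2 → Bool
Fin→bit zero    = false
Fin→bit (suc _) = true

Fin→bit∘bit→Fin : ∀ b → Fin→bit (bit→Fin b) ≡ b
Fin→bit∘bit→Fin false = refl
Fin→bit∘bit→Fin true  = refl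

bit→Fin∘Fin→bit : ∀ i → bit→Fin (Fin→bit i) ≡ i
bit→Fin∘Fin→bit zero       = refl
bit→Fin∘Fin→bit (suc zero) = refl

toFin : ∀ {n} → Bits n → Fin (2 ^ n)
toFin []      = zero
toFin (b ∷ x) = combine (bit→Fin b) (toFin x)

fromFin : ∀ {n} → Fin (2 ^ n) → Bits n
fromFin {zero}  _ = []
fromFin {suc n} i =
  Fin→bit (proj₁ (remQuot {2} (2 ^ n) i)) ∷ fromFin (proj₂ (remQuot {2} (2 ^ n) i))

fromFin∘toFin : ∀ {n} (x : Bits n) → fromFin (toFin x) ≡ x
fromFin∘toFin []      = refl
fromFin∘toFin {suc n} (b ∷ x) = cong₂ _∷_
  (trans (cong (Fin→bit ∘ proj₁) rq) (Fin→bit∘bit→Fin b))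
  (trans (cong (fromFin ∘ proj₂) rq) (fromFin∘toFin x))
  where rq = FP.remQuot-combine {2} {2 ^ n} (bit→Fin b) (toFin x)

toFin∘fromFin : ∀ {n} (i : Fin (2 ^ n)) → toFin {n} (fromFin i) ≡ i
toFin∘fromFin {zero}  zero = refl
toFin∘fromFin {suc n} i = trans
  (cong₂ combine (bit→Fin∘Fin→bit (proj₁ (remQuot {2} (2 ^ n) i))) (toFin∘fromFin {n} (proj₂ (remQuot {2} (2 ^ n) i))))
  (FP.combine-remQuot {2} (2 ^ n) i)

toFin-injective : ∀ {n} {x y : Bits n} → toFin x ≡ toFin y → x ≡ y
toFin-injective {x = x} {y} eq =
  trans (sym (fromFin∘toFin x)) (trans (cong fromFin eq) (fromFin∘toFin y))

fromFin-injective : ∀ {n} {i j : Fin (2 ^ n)} → fromFin {n} i ≡ fromFin j → i ≡ j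
fromFin-injective {n} {i} {j} eq =
  trans (sym (toFin∘fromFin {n} i)) (trans (cong toFin eq) (toFin∘fromFin {n} j))

allBits : ∀ n → List (Bits n)
allBits n = map fromFin (allFin (2 ^ n))

∈-allBits : ∀ {n} (x : Bits n) → x ∈ allBits n
∈-allBits x = subst (_∈ allBits _) (fromFin∘toFin x) (∈-map⁺ fromFin (∈-allFin (toFin x)))

allBits-unique : ∀ n → Unique (allBits n)
allBits-unique n = UP.map⁺ (fromFin-injective {n}) (UP.allFin⁺ (2 ^ n))

length-allBits : ∀ n → length (allBits n) ≡ 2 ^ n
length-allBits n = trans (length-map (fromFin {n}) (allFin (2 ^ n))) (length-tabulate {n = 2 ^ n} id)

∀Bits? : ∀ {n} {P : Bits n → Set} → (∀ x → Dec (P x)) → Dec (∀ x → P x)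
∀Bits? {P = P} P? = map′ (λ h x → subst P (fromFin∘toFin x) (h (toFin x))) (λ h i → h (fromFin i))
  (FP.all? (P? ∘ fromFin))

Unique-⊆⇒length≤ : ∀ {A : Set} {xs ys : List A} → Unique xs → (∀ {x} → x ∈ xs → x ∈ ys) →
                   length xs ≤ length ys
Unique-⊆⇒length≤ {xs = []} _ _ = z≤n
Unique-⊆⇒length≤ {xs = x ∷ xs} (x∉ ∷ u) sub with ∈-∃++ (sub (here refl))
... | as , bs , refl = begin
  suc (length xs)              ≤⟨ s≤s (Unique-⊆⇒length≤ u sub′) ⟩
  suc (length (as ++ bs))      ≡⟨ cong suc (length-++ as) ⟩
  suc (length as + length bs)  ≡⟨ +-suc (length as) (length bs) ⟨
  length as + suc (length bs)  ≡⟨ length-++ as ⟨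
  length (as ++ x ∷ bs)        ∎
  where
  open ≤-Reasoning
  sub′ : ∀ {y} → y ∈ xs → y ∈ as ++ bs
  sub′ {y} y∈ with ∈-++⁻ as (sub (there y∈))
  ... | inj₁ y∈as          = ∈-++⁺ˡ y∈as
  ... | inj₂ (here refl)   = ⊥-elim (All.lookup x∉ y∈ refl)
  ... | inj₂ (there y∈bs)  = ∈-++⁺ʳ as y∈bs

avoid : ∀ {A : Set} → DecidableEquality A → (xs ys : List A) → Unique xs → length ys < length xs →
        ∃ λ x → x ∈ xs × x ∉ ys
avoid {A} _≟_ xs ys u lt = go (filter new? xs) refl
  where
  new? : ∀ x → Dec (x ∉ ys)
  new? x = ¬? (any? (x ≟_) ys)
  ¬∈[] : ∀ {x : A} → x ∉ []
  ¬∈[] ()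
  go : ∀ zs → filter new? xs ≡ zs → ∃ λ x → x ∈ xs × x ∉ ys
  go (z ∷ _) eq = z , ∈-filter⁻ new? (subst (z ∈_) (sym eq) (here refl))
  go []      eq = ⊥-elim (<⇒≱ lt (Unique-⊆⇒length≤ u λ {x} x∈ →
    decidable-stable (any? (x ≟_) ys) λ x∉ → ¬∈[] (subst (x ∈_) eq (∈-filter⁺ new? x∈ x∉))))

flip : ∀ {m} → Bits m → Fin m → Bool → Bits m
flip x t b = V.updateAt x t (_xor b)

lookup-flip : ∀ {m} (x : Bits m) t b → V.lookup (flip x t b) t ≡ V.lookup x t xor b
lookup-flip x t b = VP.lookup∘updateAt t x

lookup-flip-≢ : ∀ {m} (x : Bits m) {i t} b → i ≢ t → V.lookup (flip x t b) i ≡ V.lookup x i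
lookup-flip-≢ x {i} {t} b i≢t = VP.lookup∘updateAt′ i t i≢t x

flip-false : ∀ {m} (x : Bits m) t → flip x t false ≡ x
flip-false x t = VP.updateAt-id-local t x (xor-identityʳ (V.lookup x t))

flip-flip : ∀ {m} (x : Bits m) t b c → flip (flip x t b) t c ≡ flip x t (b xor c)
flip-flip x t b c = VP.updateAt-updateAt-local t x (xor-assoc (V.lookup x t) b c)

flip-comm : ∀ {m} (x : Bits m) {s t} b c → s ≢ t → flip (flip x s b) t c ≡ flip (flip x t c) s b
flip-comm x {s} {t} b c s≢t = VP.updateAt-commutes t s (s≢t ∘ sym) x

conj-cong : ∀ {m} (cs : List (Fin m)) {x y : Bits m} →
            (∀ {i} → i ∈ cs → V.lookup x i ≡ V.lookup y i) → conj cs x ≡ conj cs y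
conj-cong []       eq = refl
conj-cong (c ∷ cs) eq = cong₂ _∧_ (eq (here refl)) (conj-cong cs (eq ∘ there))

∈⇒≢ : ∀ {A : Set} {x y : A} {xs} → x ∈ xs → y ∉ xs → x ≢ y
∈⇒≢ x∈ y∉ refl = y∉ x∈

conj-flip : ∀ {m} (cs : List (Fin m)) (x : Bits m) t b → t ∉ cs → conj cs (flip x t b) ≡ conj cs x
conj-flip cs x t b t∉ = conj-cong cs (λ i∈ → lookup-flip-≢ x b (∈⇒≢ i∈ t∉))

conj-++ : ∀ {m} (as bs : List (Fin m)) (x : Bits m) → conj (as ++ bs) x ≡ conj as x ∧ conj bs x
conj-++ []       bs x = refl
conj-++ (a ∷ as) bs x =
  trans (cong (V.lookup x a ∧_) (conj-++ as bs x)) (sym (∧-assoc (V.lookup x a) _ _))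

applyGate-involutive : ∀ {m} (g : Gate m) x → applyGate g (applyGate g x) ≡ x
applyGate-involutive g x = begin
  flip (flip x t b) t (conj cs (flip x t b))  ≡⟨ cong (flip (flip x t b) t) (conj-flip cs x t b (Gate.targetFree g)) ⟩
  flip (flip x t b) t b                       ≡⟨ flip-flip x t b b ⟩
  flip x t (b xor b)                          ≡⟨ cong (flip x t) (xor-same b) ⟩
  flip x t false                              ≡⟨ flip-false x t ⟩
  x                                           ∎
  where
  open ≡-Reasoning
  t  = Gate.target g
  cs = Gate.controls g
  b  = conj cs x

eval-++ : ∀ {m} (c d : Circuit m) x → evalCircuit (c ++ d) x ≡ evalCircuit d (evalCircuit c x)
eval-++ []      d x = refl
eval-++ (g ∷ c) d x = eval-++ c d (applyGate g x)

inv : ∀ {m} → Circuit m → Circuit m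
inv []      = []
inv (g ∷ c) = inv c ++ g ∷ []

length-∷ʳ : ∀ {A : Set} (xs : List A) x → length (xs ++ x ∷ []) ≡ suc (length xs)
length-∷ʳ xs x = trans (length-++ xs) (+-comm (length xs) 1)

length-inv : ∀ {m} (c : Circuit m) → length (inv c) ≡ length c
length-inv []      = refl
length-inv (g ∷ c) = trans (length-∷ʳ (inv c) g) (cong suc (length-inv c))

inv-eval : ∀ {m} (c : Circuit m) x → evalCircuit (inv c) (evalCircuit c x) ≡ x
inv-eval []      x = refl
inv-eval (g ∷ c) x = trans (eval-++ (inv c) (g ∷ []) _)
  (trans (cong (applyGate g) (inv-eval c (applyGate g x))) (applyGate-involutive g x))

eval-inv : ∀ {m} (c : Circuit m) x → evalCircuit c (evalCircuit (inv c) x) ≡ x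
eval-inv []      x = refl
eval-inv (g ∷ c) x = trans (cong (evalCircuit (g ∷ c)) (eval-++ (inv c) (g ∷ []) x))
  (trans (cong (evalCircuit c) (applyGate-involutive g _)) (eval-inv c x))

eval-injective : ∀ {m} (c : Circuit m) {x y} → evalCircuit c x ≡ evalCircuit c y → x ≡ y
eval-injective c {x} {y} eq =
  trans (sym (inv-eval c x)) (trans (cong (evalCircuit (inv c)) eq) (inv-eval c y))

not-gate : ∀ {m} → Fin m → Gate m
not-gate t = gate [] t [] (λ ()) z≤n

cnot : ∀ {m} (c t : Fin m) → t ≢ c → Gate m
cnot c t t≢c = gate (c ∷ []) t ([] ∷ []) (λ { (here eq) → t≢c eq }) (s≤s z≤n)

toffoli : ∀ {m} (c d t : Fin m) → c ≢ d → t ≢ c → t ≢ d → Gate m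
toffoli c d t c≢d t≢c t≢d = gate (c ∷ d ∷ []) t ((c≢d ∷ []) ∷ [] ∷ [])
  (λ { (here eq) → t≢c eq ; (there (here eq)) → t≢d eq }) (s≤s (s≤s z≤n))

-- Multiply controlled NOT with one borrowed line

-- One ladder: every work line wⱼ receives the product of the controls from cⱼ on.
ladderΔ : ∀ {m} → List (Fin m) → List (Fin m) → Bits m → Fin m → Bool
ladderΔ (c ∷ cs) (w ∷ ws) x i with i F.≟ w
... | yes _ = conj (c ∷ cs) x
... | no _  = ladderΔ cs ws x i
ladderΔ _ _ _ _ = false

ladderΔ-head : ∀ {m} c w (cs ws : List (Fin m)) x → ladderΔ (c ∷ cs) (w ∷ ws) x w ≡ conj (c ∷ cs) x
ladderΔ-head c w cs ws x with w F.≟ w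
... | yes _  = refl
... | no w≢w = ⊥-elim (w≢w refl)

ladderΔ-tail : ∀ {m} c w (cs ws : List (Fin m)) x {i} → i ≢ w →
               ladderΔ (c ∷ cs) (w ∷ ws) x i ≡ ladderΔ cs ws x i
ladderΔ-tail c w cs ws x {i} i≢w with i F.≟ w
... | yes i≡w = ⊥-elim (i≢w i≡w)
... | no _    = refl

ladderΔ-∉ : ∀ {m} (cs ws : List (Fin m)) x {i} → i ∉ ws → ladderΔ cs ws x i ≡ false
ladderΔ-∉ []       ws       x i∉ = refl
ladderΔ-∉ (c ∷ cs) []       x i∉ = refl
ladderΔ-∉ (c ∷ cs) (w ∷ ws) x i∉ =
  trans (ladderΔ-tail c w cs ws x (i∉ ∘ here)) (ladderΔ-∉ cs ws x (i∉ ∘ there))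

ladderΔ-cong : ∀ {m} (cs ws : List (Fin m)) {x y} i →
               (∀ {j} → j ∈ cs → V.lookup x j ≡ V.lookup y j) → ladderΔ cs ws x i ≡ ladderΔ cs ws y i
ladderΔ-cong []       ws       i eq = refl
ladderΔ-cong (c ∷ cs) []       i eq = refl
ladderΔ-cong (c ∷ cs) (w ∷ ws) i eq with i F.≟ w
... | yes _ = conj-cong (c ∷ cs) eq
... | no _  = ladderΔ-cong cs ws i (eq ∘ there)

toggle-twice : ∀ a b c d → (a xor (b ∧ (c ∧ true))) xor (b ∧ ((c xor d) ∧ true)) ≡ a xor (b ∧ d)
toggle-twice false false c     d     = refl
toggle-twice false true  false false = refl
toggle-twice false true  false true  = refl
toggle-twice false true  true  false = refl
toggle-twice false true  true  true  = refl
toggle-twice true  false c     d     = refl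
toggle-twice true  true  false false = refl
toggle-twice true  true  false true  = refl
toggle-twice true  true  true  false = refl
toggle-twice true  true  true  true  = refl

ladder : ∀ {m} (cs ws : List (Fin m)) → length cs ≤ length ws → Unique ws →
         (∀ {c} → c ∈ cs → c ∉ ws) →
         ∃ λ C → length C ≤ 2 * length cs ×
           (∀ x i → V.lookup (evalCircuit C x) i ≡ V.lookup x i xor ladderΔ cs ws x i)
ladder [] ws _ _ _ = [] , z≤n , λ x i → sym (xor-identityʳ _)
ladder (c ∷ []) (w ∷ ws) _ _ disj = cnot c w w≢c ∷ [] , s≤s z≤n , spec
  where
  w≢c : w ≢ c
  w≢c eq = disj (here refl) (here (sym eq))
  spec : ∀ x i → V.lookup (flip x w (conj (c ∷ []) x)) i ≡ V.lookup x i xor ladderΔ (c ∷ []) (w ∷ ws) x i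
  spec x i with i F.≟ w
  ... | yes refl = lookup-flip x w _
  ... | no i≢w   = trans (lookup-flip-≢ x _ i≢w) (sym (xor-identityʳ _))
ladder {m} (c ∷ cs@(c′ ∷ cs′)) (w ∷ ws@(w′ ∷ ws′)) (s≤s le) (w∉ ∷ u) disj
  with ladder cs ws le u (λ c∈ w∈ → disj (there c∈) (there w∈))
... | C , len , spec = (g ∷ C ++ g ∷ []) , len′ , spec′
  where
  c≢w′ : c ≢ w′
  c≢w′ eq = disj (here refl) (there (here eq))
  c≢w : c ≢ w
  c≢w eq = disj (here refl) (here eq)
  w≢w′ : w ≢ w′
  w≢w′ = All.lookup w∉ (here refl)
  g : Gate m
  g = toffoli c w′ w c≢w′ (c≢w ∘ sym) w≢w′
  len′ : suc (length (C ++ g ∷ [])) ≤ 2 * suc (length cs)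
  len′ = begin
    suc (length (C ++ g ∷ []))  ≡⟨ cong suc (length-∷ʳ C g) ⟩
    2 + length C                ≤⟨ +-monoʳ-≤ 2 len ⟩
    2 + 2 * length cs           ≡⟨ *-suc 2 (length cs) ⟨
    2 * suc (length cs)         ∎
    where open ≤-Reasoning
  spec′ : ∀ x i → V.lookup (evalCircuit (g ∷ C ++ g ∷ []) x) i
                ≡ V.lookup x i xor ladderΔ (c ∷ cs) (w ∷ ws) x i
  spec′ x i = trans (cong (λ z → V.lookup z i) (eval-++ C (g ∷ []) x₁)) (final (i F.≟ w))
    where
    b = V.lookup x c ∧ (V.lookup x w′ ∧ true)
    x₁ = flip x w b
    x₂ = evalCircuit C x₁
    Δ≡ : ∀ j → ladderΔ cs ws x₁ j ≡ ladderΔ cs ws x j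
    Δ≡ j = ladderΔ-cong cs ws j (λ {k} k∈ → lookup-flip-≢ x b λ { refl → disj (there k∈) (here refl) })
    off : ∀ {j} → j ≢ w → V.lookup x₂ j ≡ V.lookup x j xor ladderΔ cs ws x j
    off {j} j≢w = trans (spec x₁ j) (cong₂ _xor_ (lookup-flip-≢ x b j≢w) (Δ≡ j))
    c-val : V.lookup x₂ c ≡ V.lookup x c
    c-val = trans (off c≢w)
      (trans (cong (V.lookup x c xor_) (ladderΔ-∉ cs ws x (disj (here refl) ∘ there))) (xor-identityʳ _))
    w′-val : V.lookup x₂ w′ ≡ V.lookup x w′ xor conj cs x
    w′-val = trans (off (w≢w′ ∘ sym)) (cong (V.lookup x w′ xor_) (ladderΔ-head c′ w′ cs′ ws′ x))
    w-val : V.lookup x₂ w ≡ V.lookup x w xor b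
    w-val = trans (spec x₁ w) (trans (cong₂ _xor_ (lookup-flip x w b)
      (ladderΔ-∉ cs ws x₁ (λ w∈ → All.lookup w∉ w∈ refl))) (xor-identityʳ _))
    final : Dec (i ≡ w) → V.lookup (applyGate g x₂) i ≡ V.lookup x i xor ladderΔ (c ∷ cs) (w ∷ ws) x i
    final (yes refl) = begin
      V.lookup (applyGate g x₂) w
        ≡⟨ lookup-flip x₂ w _ ⟩
      V.lookup x₂ w xor (V.lookup x₂ c ∧ (V.lookup x₂ w′ ∧ true))
        ≡⟨ cong₂ _xor_ w-val (cong₂ (λ p r → p ∧ (r ∧ true)) c-val w′-val) ⟩
      (V.lookup x w xor b) xor (V.lookup x c ∧ ((V.lookup x w′ xor conj cs x) ∧ true))
        ≡⟨ toggle-twice (V.lookup x w) (V.lookup x c) (V.lookup x w′) (conj cs x) ⟩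
      V.lookup x w xor conj (c ∷ cs) x
        ≡⟨ cong (V.lookup x w xor_) (ladderΔ-head c w cs ws x) ⟨
      V.lookup x w xor ladderΔ (c ∷ cs) (w ∷ ws) x w ∎
      where open ≡-Reasoning
    final (no i≢w) = trans (lookup-flip-≢ x₂ _ i≢w)
      (trans (off i≢w) (cong (V.lookup x i xor_) (sym (ladderΔ-tail c w cs ws x i≢w))))

Controlled : ∀ {m} → List (Fin m) → Fin m → Circuit m → Set
Controlled cs t C = ∀ x → evalCircuit C x ≡ flip x t (conj cs x)

xor-cancel : ∀ a b → (a xor b) xor b ≡ a
xor-cancel a b = trans (xor-assoc a b b) (trans (cong (a xor_) (xor-same b)) (xor-identityʳ a))

-- The second, shorter ladder restores the borrowed lines ws, whatever their contents.
controlled-manyBorrowed : ∀ {m} c (cs : List (Fin m)) t ws → length cs ≤ length ws → Unique (t ∷ ws) →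
  (∀ {d} → d ∈ c ∷ cs → d ∉ t ∷ ws) →
  ∃ λ C → length C ≤ 2 + 4 * length cs × Controlled (c ∷ cs) t C
controlled-manyBorrowed c cs t ws le u@(t∉ ∷ uws) disj
  with ladder (c ∷ cs) (t ∷ ws) (s≤s le) u disj | ladder cs ws le uws (λ d∈ → disj (there d∈) ∘ there)
... | A , lenA , specA | B , lenB , specB = A ++ B , len , spec
  where
  len : length (A ++ B) ≤ 2 + 4 * length cs
  len = begin
    length (A ++ B)                          ≡⟨ length-++ A ⟩
    length A + length B                      ≤⟨ +-mono-≤ lenA lenB ⟩
    2 * suc (length cs) + 2 * length cs      ≡⟨ arith (length cs) ⟩
    2 + 4 * length cs                        ∎
    where
    open ≤-Reasoning
    arith : ∀ a → 2 * suc a + 2 * a ≡ 2 + 4 * a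
    arith = solve-∀
  spec : Controlled (c ∷ cs) t (A ++ B)
  spec x = trans (eval-++ A B x) (lookup-ext λ i → trans (specB y i) (at i (i F.≟ t)))
    where
    y = evalCircuit A x
    Δ≡ : ∀ i → ladderΔ cs ws y i ≡ ladderΔ cs ws x i
    Δ≡ i = ladderΔ-cong cs ws i λ {j} j∈ → trans (specA x j)
      (trans (cong (V.lookup x j xor_) (ladderΔ-∉ (c ∷ cs) (t ∷ ws) x (disj (there j∈)))) (xor-identityʳ _))
    at : ∀ i → Dec (i ≡ t) → V.lookup y i xor ladderΔ cs ws y i ≡ V.lookup (flip x t (conj (c ∷ cs) x)) i
    at i (yes refl) = trans (cong₂ _xor_ (specA x i)
        (trans (Δ≡ i) (ladderΔ-∉ cs ws x (λ t∈ → All.lookup t∉ t∈ refl))))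
      (trans (xor-identityʳ _) (trans (cong (V.lookup x i xor_) (ladderΔ-head c i cs ws x)) (sym (lookup-flip x i _))))
    at i (no i≢t) = trans (cong₂ _xor_ (trans (specA x i) (cong (V.lookup x i xor_) (ladderΔ-tail c t cs ws x i≢t))) (Δ≡ i))
      (trans (xor-cancel (V.lookup x i) _) (sym (lookup-flip-≢ x _ i≢t)))

halves : ∀ {A : Set} (xs : List A) →
         ∃ λ as → ∃ λ bs → as ++ bs ≡ xs × length bs ≤ length as × length as ≤ suc (length bs)
halves xs = take h xs , drop h xs , take++drop≡id h xs ,
  ≤-trans (≤-reflexive lenb) (≤-trans (⌊n/2⌋≤⌈n/2⌉ n) (≤-reflexive (sym lena))) ,
  ≤-trans (≤-reflexive lena) (≤-trans (⌊n/2⌋-mono {suc n} {2 + n} (n≤1+n _)) (≤-reflexive (cong suc (sym lenb))))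
  where
  n = length xs
  h = ⌈ n /2⌉
  lena : length (take h xs) ≡ h
  lena = trans (length-take h xs) (m≤n⇒m⊓n≡m (⌈n/2⌉≤n n))
  lenb : length (drop h xs) ≡ ⌊ n /2⌋
  lenb = trans (length-drop h xs) (trans (cong (_∸ h) (sym (⌊n/2⌋+⌈n/2⌉≡n n))) (m+n∸n≡m ⌊ n /2⌋ h))

Unique-++⁻ : ∀ {A : Set} (as : List A) {bs} → Unique (as ++ bs) →
             Unique as × Unique bs × (∀ {x} → x ∈ as → x ∉ bs)
Unique-++⁻ []       u        = [] , u , λ ()
Unique-++⁻ (a ∷ as) (a∉ ∷ u) with Unique-++⁻ as u
... | uas , ubs , disj = AllP.++⁻ˡ as a∉ ∷ uas , ubs ,
  λ { (here refl) x∈ → All.lookup (AllP.++⁻ʳ as a∉) x∈ refl ; (there x∈) → disj x∈ }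

∉-++⁻ : ∀ {A : Set} (as : List A) {bs x} → x ∉ as ++ bs → x ∉ as × x ∉ bs
∉-++⁻ as x∉ = x∉ ∘ ∈-++⁺ˡ , x∉ ∘ ∈-++⁺ʳ as

∉⇒All≢ : ∀ {A : Set} {x : A} {xs} → x ∉ xs → All (x ≢_) xs
∉⇒All≢ x∉ = All.tabulate λ y∈ x≡y → x∉ (subst (_∈ _) (sym x≡y) y∈)

absorb-twice : ∀ a b c e → (a xor ((b xor c) ∧ e)) xor (b ∧ e) ≡ a xor (c ∧ e)
absorb-twice false false false false = refl
absorb-twice false false false true  = refl
absorb-twice false false true  false = refl
absorb-twice false false true  true  = refl
absorb-twice false true  false false = refl
absorb-twice false true  false true  = refl
absorb-twice false true  true  false = refl
absorb-twice false true  true  true  = refl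
absorb-twice true  false false false = refl
absorb-twice true  false false true  = refl
absorb-twice true  false true  false = refl
absorb-twice true  false true  true  = refl
absorb-twice true  true  false false = refl
absorb-twice true  true  false true  = refl
absorb-twice true  true  true  false = refl
absorb-twice true  true  true  true  = refl

controlled : ∀ {m} (cs : List (Fin m)) t w → Unique cs → t ∉ cs → w ∉ cs → w ≢ t →
             ∃ λ C → length C ≤ 8 * length cs + 8 × Controlled cs t C
controlled [] t w _ _ _ _ = not-gate t ∷ [] , s≤s z≤n , λ x → refl
controlled {m} cs@(_ ∷ _) t w u t∉ w∉ w≢t with halves cs
... | [] , [] , () , _ , _
... | [] , _ ∷ _ , _ , () , _
... | as@(a ∷ as′) , bs , as++bs , b≤a , s≤s a≤b
  with Unique-++⁻ as (subst Unique (sym as++bs) u)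
     | ∉-++⁻ as (subst (t ∉_) (sym as++bs) t∉)
     | ∉-++⁻ as (subst (w ∉_) (sym as++bs) w∉)
... | uas , ubs , disj | t∉as , t∉bs | w∉as , w∉bs
  with controlled-manyBorrowed a as′ w bs a≤b (∉⇒All≢ w∉bs ∷ ubs)
         (λ { d∈ (here refl) → w∉as d∈ ; d∈ (there d∈bs) → disj d∈ d∈bs })
     | controlled-manyBorrowed w bs t as b≤a (∉⇒All≢ t∉as ∷ uas)
         (λ { (here refl) (here w≡t) → w≢t w≡t ; (here refl) (there w∈) → w∉as w∈
            ; (there d∈) (here refl) → t∉bs d∈ ; (there d∈) (there d∈as) → disj d∈as d∈ })
... | G , lenG , specG | H , lenH , specH = (G ++ H) ++ (G ++ H) , len , spec
  where
  len : length ((G ++ H) ++ (G ++ H)) ≤ 8 * length cs + 8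
  len = begin
    length ((G ++ H) ++ (G ++ H))              ≡⟨ length-++ (G ++ H) ⟩
    length (G ++ H) + length (G ++ H)          ≡⟨ cong (λ l → l + l) (length-++ G) ⟩
    (length G + length H) + (length G + length H)
      ≤⟨ +-mono-≤ (+-mono-≤ lenG lenH) (+-mono-≤ lenG lenH) ⟩
    ((2 + 4 * length as′) + (2 + 4 * length bs)) + ((2 + 4 * length as′) + (2 + 4 * length bs))
      ≡⟨ arith (length as′) (length bs) ⟩
    8 * (length as′ + length bs) + 8           ≤⟨ +-monoˡ-≤ 8 (*-monoʳ-≤ 8 (n≤1+n _)) ⟩
    8 * (length as + length bs) + 8            ≡⟨ cong (λ l → 8 * l + 8) (trans (sym (length-++ as)) (cong length as++bs)) ⟩
    8 * length cs + 8                          ∎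
    where
    open ≤-Reasoning
    arith : ∀ a b → ((2 + 4 * a) + (2 + 4 * b)) + ((2 + 4 * a) + (2 + 4 * b)) ≡ 8 * (a + b) + 8
    arith = solve-∀
  spec : Controlled cs t ((G ++ H) ++ (G ++ H))
  spec x = begin
    evalCircuit ((G ++ H) ++ (G ++ H)) x              ≡⟨ eval-++ (G ++ H) (G ++ H) x ⟩
    evalCircuit (G ++ H) (evalCircuit (G ++ H) x)     ≡⟨ cong (evalCircuit (G ++ H)) (once x) ⟩
    evalCircuit (G ++ H) y                            ≡⟨ once y ⟩
    step y                                            ≡⟨ lookup-ext (λ i → at i (i F.≟ t) (i F.≟ w)) ⟩
    flip x t (conj as x ∧ conj bs x)                  ≡⟨ cong (flip x t) (conj-++ as bs x) ⟨
    flip x t (conj (as ++ bs) x)                      ≡⟨ cong (λ l → flip x t (conj l x)) as++bs ⟩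
    flip x t (conj cs x)                              ∎
    where
    open ≡-Reasoning
    z₁ step : Bits m → Bits m
    z₁ z = flip z w (conj as z)
    step z = flip (z₁ z) t ((V.lookup z w xor conj as z) ∧ conj bs z)
    once : ∀ z → evalCircuit (G ++ H) z ≡ step z
    once z = trans (eval-++ G H z) (trans (specH _) (trans (cong (λ z′ → flip z′ t (conj (w ∷ bs) z′)) (specG z))
      (cong (flip _ t) (cong₂ _∧_ (lookup-flip z w _) (conj-flip bs z w _ w∉bs)))))
    y = step x
    off : ∀ z {i} → i ≢ t → i ≢ w → V.lookup (step z) i ≡ V.lookup z i
    off z i≢t i≢w = trans (lookup-flip-≢ (z₁ z) _ i≢t) (lookup-flip-≢ z _ i≢w)
    at-w : ∀ z → V.lookup (step z) w ≡ V.lookup z w xor conj as z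
    at-w z = trans (lookup-flip-≢ (z₁ z) _ w≢t) (lookup-flip z w _)
    at-t : ∀ z → V.lookup (step z) t ≡ V.lookup z t xor ((V.lookup z w xor conj as z) ∧ conj bs z)
    at-t z = trans (lookup-flip (z₁ z) t _) (cong (_xor _) (lookup-flip-≢ z _ (w≢t ∘ sym)))
    as≡ : conj as y ≡ conj as x
    as≡ = conj-cong as λ i∈ → off x (∈⇒≢ i∈ t∉as) (∈⇒≢ i∈ w∉as)
    bs≡ : conj bs y ≡ conj bs x
    bs≡ = conj-cong bs λ i∈ → off x (∈⇒≢ i∈ t∉bs) (∈⇒≢ i∈ w∉bs)
    w-restored : V.lookup y w xor conj as y ≡ V.lookup x w
    w-restored = trans (cong₂ _xor_ (at-w x) as≡) (xor-cancel (V.lookup x w) (conj as x))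
    at : ∀ i → Dec (i ≡ t) → Dec (i ≡ w) → V.lookup (step y) i ≡ V.lookup (flip x t (conj as x ∧ conj bs x)) i
    at i (yes refl) _ = begin
      V.lookup (step y) i
        ≡⟨ at-t y ⟩
      V.lookup y i xor ((V.lookup y w xor conj as y) ∧ conj bs y)
        ≡⟨ cong₂ _xor_ (at-t x) (cong₂ _∧_ w-restored bs≡) ⟩
      (V.lookup x i xor ((V.lookup x w xor conj as x) ∧ conj bs x)) xor (V.lookup x w ∧ conj bs x)
        ≡⟨ absorb-twice (V.lookup x i) (V.lookup x w) (conj as x) (conj bs x) ⟩
      V.lookup x i xor (conj as x ∧ conj bs x)
        ≡⟨ lookup-flip x i _ ⟨
      V.lookup (flip x i (conj as x ∧ conj bs x)) i ∎
    at i (no i≢t) (yes refl) = trans (at-w y) (trans w-restored (sym (lookup-flip-≢ x _ i≢t)))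
    at i (no i≢t) (no i≢w) = trans (off y i≢t i≢w) (trans (off x i≢t i≢w) (sym (lookup-flip-≢ x _ i≢t)))

match : ∀ {m} → List (Fin m) → Bits m → Bits m → Bool
match []       u x = true
match (i ∷ is) u x = not (V.lookup x i xor V.lookup u i) ∧ match is u x

nots : ∀ {m} → List (Fin m) → Bits m → Circuit m
nots []       u = []
nots (i ∷ is) u with V.lookup u i
... | true  = nots is u
... | false = not-gate i ∷ nots is u

length-nots : ∀ {m} (cs : List (Fin m)) u → length (nots cs u) ≤ length cs
length-nots []       u = z≤n
length-nots (i ∷ is) u with V.lookup u i
... | true  = m≤n⇒m≤1+n (length-nots is u)
... | false = s≤s (length-nots is u)

nots-∉ : ∀ {m} (cs : List (Fin m)) u x {i} → i ∉ cs → V.lookup (evalCircuit (nots cs u) x) i ≡ V.lookup x i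
nots-∉ []       u x i∉ = refl
nots-∉ (c ∷ cs) u x i∉ with V.lookup u c
... | true  = nots-∉ cs u x (i∉ ∘ there)
... | false = trans (nots-∉ cs u _ (i∉ ∘ there)) (lookup-flip-≢ x true (i∉ ∘ here))

xor-true : ∀ a → a xor true ≡ not (a xor false)
xor-true false = refl
xor-true true  = refl

not-xor-true : ∀ a → a ≡ not (a xor true)
not-xor-true false = refl
not-xor-true true  = refl

nots-∈ : ∀ {m} (cs : List (Fin m)) u x {i} → Unique cs → i ∈ cs →
         V.lookup (evalCircuit (nots cs u) x) i ≡ not (V.lookup x i xor V.lookup u i)
nots-∈ (c ∷ cs) u x (c∉ ∷ uc) (here refl) with V.lookup u c
... | true  = trans (nots-∉ cs u x (λ c∈ → All.lookup c∉ c∈ refl)) (not-xor-true (V.lookup x c))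
... | false = trans (nots-∉ cs u _ (λ c∈ → All.lookup c∉ c∈ refl)) (trans (lookup-flip x c true) (xor-true (V.lookup x c)))
nots-∈ (c ∷ cs) u x {i} (c∉ ∷ uc) (there i∈) with V.lookup u c
... | true  = nots-∈ cs u x uc i∈
... | false = trans (nots-∈ cs u _ uc i∈)
  (cong (λ b → not (b xor V.lookup u i)) (lookup-flip-≢ x true λ { refl → All.lookup c∉ i∈ refl }))

conj-match : ∀ {m} (cs : List (Fin m)) u x y →
             (∀ {i} → i ∈ cs → V.lookup y i ≡ not (V.lookup x i xor V.lookup u i)) → conj cs y ≡ match cs u x
conj-match []       u x y eq = refl
conj-match (c ∷ cs) u x y eq = cong₂ _∧_ (eq (here refl)) (conj-match cs u x y (eq ∘ there))

match-false : ∀ {m} (cs : List (Fin m)) u x {i} → i ∈ cs → V.lookup x i ≢ V.lookup u i → match cs u x ≡ false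
match-false (c ∷ cs) u x (here refl) neq with V.lookup x c | V.lookup u c
... | false | false = ⊥-elim (neq refl)
... | false | true  = refl
... | true  | false = refl
... | true  | true  = ⊥-elim (neq refl)
match-false (c ∷ cs) u x (there i∈) neq = trans (cong (_ ∧_) (match-false cs u x i∈ neq)) (∧-comm _ false)

match-true : ∀ {m} (cs : List (Fin m)) u x → (∀ {i} → i ∈ cs → V.lookup x i ≡ V.lookup u i) → match cs u x ≡ true
match-true []       u x eq = refl
match-true (c ∷ cs) u x eq = cong₂ _∧_ (trans (cong (λ b → not (b xor V.lookup u c)) (eq (here refl))) (cong not (xor-same (V.lookup u c))))
  (match-true cs u x (eq ∘ there))

controlled-match : ∀ {m} (cs : List (Fin m)) u t w → Unique cs → t ∉ cs → w ∉ cs → w ≢ t →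
  ∃ λ C → length C ≤ 10 * length cs + 8 × (∀ x → evalCircuit C x ≡ flip x t (match cs u x))
controlled-match cs u t w uc t∉ w∉ w≢t with controlled cs t w uc t∉ w∉ w≢t
... | C , len , spec = N ++ (C ++ N) , len′ , spec′
  where
  N = nots cs u
  len′ : length (N ++ (C ++ N)) ≤ 10 * length cs + 8
  len′ = begin
    length (N ++ (C ++ N))                     ≡⟨ trans (length-++ N) (cong (length N +_) (length-++ C)) ⟩
    length N + (length C + length N)           ≤⟨ +-mono-≤ (length-nots cs u) (+-mono-≤ len (length-nots cs u)) ⟩
    length cs + ((8 * length cs + 8) + length cs) ≡⟨ arith (length cs) ⟩
    10 * length cs + 8                         ∎
    where
    open ≤-Reasoning
    arith : ∀ a → a + ((8 * a + 8) + a) ≡ 10 * a + 8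
    arith = solve-∀
  spec′ : ∀ x → evalCircuit (N ++ (C ++ N)) x ≡ flip x t (match cs u x)
  spec′ x = begin
    evalCircuit (N ++ (C ++ N)) x            ≡⟨ trans (eval-++ N (C ++ N) x) (eval-++ C N y) ⟩
    evalCircuit N (evalCircuit C y)          ≡⟨ cong (evalCircuit N) (spec y) ⟩
    evalCircuit N (flip y t (conj cs y))     ≡⟨ cong (evalCircuit N ∘ flip y t) (conj-match cs u x y (nots-∈ cs u x uc)) ⟩
    evalCircuit N (flip y t b)               ≡⟨ lookup-ext (λ i → at i (any? (i F.≟_) cs) (i F.≟ t)) ⟩
    flip x t b                               ∎
    where
    open ≡-Reasoning
    y = evalCircuit N x
    b = match cs u x
    double : ∀ p r → not (not (p xor r) xor r) ≡ p
    double false false = refl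
    double false true  = refl
    double true  false = refl
    double true  true  = refl
    at : ∀ i → Dec (i ∈ cs) → Dec (i ≡ t) → V.lookup (evalCircuit N (flip y t b)) i ≡ V.lookup (flip x t b) i
    at i (yes i∈) _ = begin
      V.lookup (evalCircuit N (flip y t b)) i
        ≡⟨ nots-∈ cs u _ uc i∈ ⟩
      not (V.lookup (flip y t b) i xor V.lookup u i)
        ≡⟨ cong (λ r → not (r xor V.lookup u i)) (trans (lookup-flip-≢ y b (∈⇒≢ i∈ t∉)) (nots-∈ cs u x uc i∈)) ⟩
      not (not (V.lookup x i xor V.lookup u i) xor V.lookup u i)
        ≡⟨ double (V.lookup x i) (V.lookup u i) ⟩
      V.lookup x i
        ≡⟨ lookup-flip-≢ x b (∈⇒≢ i∈ t∉) ⟨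
      V.lookup (flip x t b) i ∎
    at i (no i∉) (yes refl) = trans (nots-∉ cs u _ i∉) (trans (lookup-flip y i b)
      (trans (cong (_xor b) (nots-∉ cs u x i∉)) (sym (lookup-flip x i b))))
    at i (no i∉) (no i≢t) = trans (nots-∉ cs u _ i∉) (trans (lookup-flip-≢ y b i≢t)
      (trans (nots-∉ cs u x i∉) (sym (lookup-flip-≢ x b i≢t))))

-- Table lookup

flips : ∀ {m} → List (Fin m) → Bits m → Bits m
flips []       x = x
flips (t ∷ ts) x = flips ts (flip x t true)

lookup-flips-∉ : ∀ {m} (ts : List (Fin m)) x {i} → i ∉ ts → V.lookup (flips ts x) i ≡ V.lookup x i
lookup-flips-∉ []       x i∉ = refl
lookup-flips-∉ (t ∷ ts) x i∉ =
  trans (lookup-flips-∉ ts (flip x t true) (i∉ ∘ there)) (lookup-flip-≢ x true (i∉ ∘ here))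

lookup-flips-∈ : ∀ {m} (ts : List (Fin m)) x {i} → Unique ts → i ∈ ts →
                 V.lookup (flips ts x) i ≡ V.lookup x i xor true
lookup-flips-∈ (t ∷ ts) x (t∉ ∷ u) (here refl) =
  trans (lookup-flips-∉ ts (flip x t true) (λ t∈ → All.lookup t∉ t∈ refl)) (lookup-flip x t true)
lookup-flips-∈ (t ∷ ts) x (t∉ ∷ u) (there i∈) =
  trans (lookup-flips-∈ ts (flip x t true) u i∈)
    (cong (_xor true) (lookup-flip-≢ x true λ { refl → All.lookup t∉ i∈ refl }))

match-true⁻ : ∀ {m} (cs : List (Fin m)) u x → match cs u x ≡ true →
              ∀ {i} → i ∈ cs → V.lookup x i ≡ V.lookup u i
match-true⁻ cs u x eq {i} i∈ with V.lookup x i B.≟ V.lookup u i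
... | yes e = e
... | no ne with () ← trans (sym eq) (match-false cs u x i∈ ne)

match-cong : ∀ {m} (cs : List (Fin m)) u {x y} →
             (∀ {i} → i ∈ cs → V.lookup x i ≡ V.lookup y i) → match cs u x ≡ match cs u y
match-cong []       u eq = refl
match-cong (c ∷ cs) u eq =
  cong₂ _∧_ (cong (λ b → not (b xor V.lookup u c)) (eq (here refl))) (match-cong cs u (eq ∘ there))

controlled-flips : ∀ {m} (cs : List (Fin m)) u z ts → Unique cs → z ∉ cs → z ∉ ts →
  (∀ {t} → t ∈ ts → t ∉ cs) →
  ∃ λ C → length C ≤ length ts * (10 * length cs + 8) ×
    (∀ x → match cs u x ≡ true → evalCircuit C x ≡ flips ts x) ×
    (∀ x → match cs u x ≡ false → evalCircuit C x ≡ x)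
controlled-flips cs u z [] uc z∉cs z∉ts disj = [] , z≤n , (λ x _ → refl) , (λ x _ → refl)
controlled-flips cs u z (t ∷ ts) uc z∉cs z∉ts disj
  with controlled-match cs u t z uc (disj (here refl)) z∉cs (z∉ts ∘ here)
     | controlled-flips cs u z ts uc z∉cs (z∉ts ∘ there) (disj ∘ there)
... | A , lenA , specA | B , lenB , onB , offB = A ++ B , len , on , off
  where
  len : length (A ++ B) ≤ length (t ∷ ts) * (10 * length cs + 8)
  len = ≤-trans (≤-reflexive (length-++ A)) (+-mono-≤ lenA lenB)
  match-flip : ∀ x b → match cs u (flip x t b) ≡ match cs u x
  match-flip x b = match-cong cs u λ i∈ → lookup-flip-≢ x b (∈⇒≢ i∈ (disj (here refl)))
  on : ∀ x → match cs u x ≡ true → evalCircuit (A ++ B) x ≡ flips (t ∷ ts) x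
  on x eq = trans (eval-++ A B x)
    (trans (cong (evalCircuit B) (trans (specA x) (cong (flip x t) eq)))
           (onB (flip x t true) (trans (match-flip x true) eq)))
  off : ∀ x → match cs u x ≡ false → evalCircuit (A ++ B) x ≡ x
  off x eq = trans (eval-++ A B x)
    (trans (cong (evalCircuit B) (trans (specA x) (trans (cong (flip x t) eq) (flip-false x t)))) (offB x eq))

Agree : ∀ {m} → List (Fin m) → Bits m → Bits m → Set
Agree cs x y = ∀ {i} → i ∈ cs → V.lookup x i ≡ V.lookup y i

tableLookup : ∀ {m k} (cs : List (Fin m)) (ts : List (Fin m)) z (u v : Bits k → Bits m) →
  Unique cs → Unique ts → z ∉ cs → z ∉ ts → (∀ {t} → t ∈ ts → t ∉ cs) →
  (∀ a a′ → Agree cs (u a) (u a′) → a ≡ a′) →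
  ∃ λ C → length C ≤ 2 ^ k * (length ts * (10 * length cs + 8)) ×
    (∀ a y → Agree cs y (u a) →
      (∀ {i} → i ∈ ts → V.lookup (evalCircuit C y) i ≡ V.lookup y i xor V.lookup (v a) i) ×
      (∀ {i} → i ∉ ts → V.lookup (evalCircuit C y) i ≡ V.lookup y i))
tableLookup {m} {k} cs ts z u v uc ut z∉cs z∉ts disj sep with rows (allBits k) (allBits-unique k)
  where
  selected : Bits k → List (Fin m)
  selected a = filter (λ t → V.lookup (v a) t B.≟ true) ts
  rows : ∀ as → Unique as →
    ∃ λ C → length C ≤ length as * (length ts * (10 * length cs + 8)) ×
      (∀ a y → Agree cs y (u a) →
        (a ∈ as → evalCircuit C y ≡ flips (selected a) y) × (a ∉ as → evalCircuit C y ≡ y))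
  rows [] _ = [] , z≤n , λ a y _ → (λ ()) , λ _ → refl
  rows (b ∷ as) (b∉ ∷ ua)
    with controlled-flips cs (u b) z (selected b) uc z∉cs
           (z∉ts ∘ proj₁ ∘ ∈-filter⁻ (λ t → V.lookup (v b) t B.≟ true))
           (disj ∘ proj₁ ∘ ∈-filter⁻ (λ t → V.lookup (v b) t B.≟ true))
       | rows as ua
  ... | A , lenA , onA , offA | B , lenB , specB = A ++ B , len , spec
    where
    len : length (A ++ B) ≤ length (b ∷ as) * (length ts * (10 * length cs + 8))
    len = ≤-trans (≤-reflexive (length-++ A))
      (+-mono-≤ (≤-trans lenA (*-monoˡ-≤ _ (length-filter (λ t → V.lookup (v b) t B.≟ true) ts))) lenB)
    keeps : ∀ y → Agree cs (flips (selected b) y) y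
    keeps y i∈ = lookup-flips-∉ (selected b) y
      (λ i∈s → disj (proj₁ (∈-filter⁻ (λ t → V.lookup (v b) t B.≟ true) i∈s)) i∈)
    spec : ∀ a y → Agree cs y (u a) →
      (a ∈ b ∷ as → evalCircuit (A ++ B) y ≡ flips (selected a) y) ×
      (a ∉ b ∷ as → evalCircuit (A ++ B) y ≡ y)
    spec a y agr with a ≟ᵇ b
    ... | yes refl = (λ _ → trans (eval-++ A B y) (trans (cong (evalCircuit B) (onA y (match-true cs (u b) y agr)))
            (proj₂ (specB a _ (λ i∈ → trans (keeps y i∈) (agr i∈))) λ a∈ → All.lookup b∉ a∈ refl)))
      , λ a∉ → ⊥-elim (a∉ (here refl))
    ... | no a≢b = (λ { (here a≡b) → ⊥-elim (a≢b a≡b) ; (there a∈) → trans skip (proj₁ (specB a y agr) a∈) })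
      , λ a∉ → trans skip (proj₂ (specB a y agr) (a∉ ∘ there))
      where
      nomatch : match cs (u b) y ≡ false
      nomatch with match cs (u b) y in eq
      ... | false = refl
      ... | true  = ⊥-elim (a≢b (sep a b λ i∈ → trans (sym (agr i∈)) (match-true⁻ cs (u b) y eq i∈)))
      skip : evalCircuit (A ++ B) y ≡ evalCircuit B y
      skip = trans (eval-++ A B y) (cong (evalCircuit B) (offA y nomatch))
... | C , len , spec = C , subst (λ l → length C ≤ l * _) (length-allBits k) len , λ a y agr → 
  (λ {i} i∈ → trans (cong (λ w → V.lookup w i) (proj₁ (spec a y agr) (∈-allBits a))) (on a y i∈))
  , (λ {i} i∉ → trans (cong (λ w → V.lookup w i) (proj₁ (spec a y agr) (∈-allBits a)))
      (lookup-flips-∉ _ y (i∉ ∘ proj₁ ∘ ∈-filter⁻ (λ t → V.lookup (v a) t B.≟ true))))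
  where
  on : ∀ a y {i} → i ∈ ts → V.lookup (flips (filter (λ t → V.lookup (v a) t B.≟ true) ts) y) i
                            ≡ V.lookup y i xor V.lookup (v a) i
  on a y {i} i∈ = go (V.lookup (v a) i) refl
    where
    sel? = λ t → V.lookup (v a) t B.≟ true
    go : ∀ b → V.lookup (v a) i ≡ b → V.lookup (flips (filter sel? ts) y) i ≡ V.lookup y i xor V.lookup (v a) i
    go true eq = trans (lookup-flips-∈ _ y (UP.filter⁺ sel? ut) (∈-filter⁺ sel? i∈ eq))
                      (cong (V.lookup y i xor_) (sym eq))
    go false eq = trans (lookup-flips-∉ (filter sel? ts) y i∉)
                      (trans (sym (xor-identityʳ _)) (cong (V.lookup y i xor_) (sym eq)))
      where
      i∉ : i ∉ filter sel? ts
      i∉ i∈s with () ← trans (sym eq) (proj₂ (∈-filter⁻ sel? {xs = ts} i∈s))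

representatives : ∀ {A B : Set} → DecidableEquality B → (f : A → B) (xs : List A) →
  ∃ λ rs → Unique (map f rs) × (∀ {x} → x ∈ xs → ∃ λ r → r ∈ rs × f r ≡ f x)
representatives _≟_ f [] = [] , [] , λ ()
representatives _≟_ f (x ∷ xs) with representatives _≟_ f xs
... | rs , u , rep with any? (f x ≟_) (map f rs)
... | yes fx∈ = rs , u , λ { (here refl) → let r , r∈ , eq = ∈-map⁻ f fx∈ in r , r∈ , sym eq ; (there x∈) → rep x∈ }
... | no fx∉  = x ∷ rs , ∉⇒All≢ fx∉ ∷ u ,
  λ { (here refl) → x , here refl , refl ; (there x∈) → let r , r∈ , eq = rep x∈ in r , there r∈ , eq }

copies : ∀ {m} (rep : Fin m → Fin m) (is : List (Fin m)) → Unique is → (∀ i → rep i ∉ is) →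
  ∃ λ C → length C ≤ length is ×
    (∀ x {i} → i ∈ is → V.lookup (evalCircuit C x) i ≡ V.lookup x i xor V.lookup x (rep i)) ×
    (∀ x {i} → i ∉ is → V.lookup (evalCircuit C x) i ≡ V.lookup x i)
copies rep [] u rep∉ = [] , z≤n , (λ x ()) , λ x _ → refl
copies rep (j ∷ is) (j∉ ∷ u) rep∉ with copies rep is u (λ i → rep∉ i ∘ there)
... | C , len , on , off = g ∷ C , s≤s len , on′ , off′
  where
  g = cnot (rep j) j λ j≡r → rep∉ j (here (sym j≡r))
  b : Bits _ → Bool
  b x = V.lookup x (rep j) ∧ true
  b≡ : ∀ x → b x ≡ V.lookup x (rep j)
  b≡ x = ∧-comm (V.lookup x (rep j)) true
  on′ : ∀ x {i} → i ∈ j ∷ is → V.lookup (evalCircuit C (flip x j (b x))) i ≡ V.lookup x i xor V.lookup x (rep i)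
  on′ x (here refl) = trans (off _ (λ j∈ → All.lookup j∉ j∈ refl))
    (trans (lookup-flip x j _) (cong (V.lookup x j xor_) (b≡ x)))
  on′ x {i} (there i∈) = trans (on _ i∈) (cong₂ _xor_
    (lookup-flip-≢ x _ λ { refl → All.lookup j∉ i∈ refl })
    (lookup-flip-≢ x _ λ r≡j → rep∉ i (here r≡j)))
  off′ : ∀ x {i} → i ∉ j ∷ is → V.lookup (evalCircuit C (flip x j (b x))) i ≡ V.lookup x i
  off′ x i∉ = trans (off _ (i∉ ∘ there)) (lookup-flip-≢ x _ (i∉ ∘ here))

spread : ∀ {m k} → Vec (Fin m) k → Bits k → Bits m
spread []       []       = V.replicate _ false
spread (l ∷ ls) (b ∷ bs) = flip (spread ls bs) l b

lookup-spread-∉ : ∀ {m k} (ls : Vec (Fin m) k) b {i} → i ∉ V.toList ls → V.lookup (spread ls b) i ≡ false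
lookup-spread-∉ []       []       {i} i∉ = VP.lookup-replicate i false
lookup-spread-∉ (l ∷ ls) (b ∷ bs) i∉ =
  trans (lookup-flip-≢ (spread ls bs) b (i∉ ∘ here)) (lookup-spread-∉ ls bs (i∉ ∘ there))

lookup∈toList : ∀ {A : Set} {k} (xs : Vec A k) j → V.lookup xs j ∈ V.toList xs
lookup∈toList (x ∷ xs) zero    = here refl
lookup∈toList (x ∷ xs) (suc j) = there (lookup∈toList xs j)

∈toList⇒lookup : ∀ {A : Set} {k} (xs : Vec A k) {x} → x ∈ V.toList xs → ∃ λ j → V.lookup xs j ≡ x
∈toList⇒lookup (x ∷ xs) (here refl) = zero , refl
∈toList⇒lookup (x ∷ xs) (there x∈) = let j , eq = ∈toList⇒lookup xs x∈ in suc j , eq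

lookup-spread : ∀ {m k} (ls : Vec (Fin m) k) b → Unique (V.toList ls) → ∀ j →
                V.lookup (spread ls b) (V.lookup ls j) ≡ V.lookup b j
lookup-spread (l ∷ ls) (b ∷ bs) (l∉ ∷ u) zero =
  trans (lookup-flip (spread ls bs) l b) (cong (_xor b) (lookup-spread-∉ ls bs λ l∈ → All.lookup l∉ l∈ refl))
lookup-spread (l ∷ ls) (b ∷ bs) (l∉ ∷ u) (suc j) =
  trans (lookup-flip-≢ (spread ls bs) b λ eq → All.lookup l∉ (lookup∈toList ls j) (sym eq))
        (lookup-spread ls bs u j)

toList-injective : ∀ {A : Set} {k} (xs : Vec A k) → Unique (V.toList xs) →
                   ∀ {i j} → V.lookup xs i ≡ V.lookup xs j → i ≡ j
toList-injective (x ∷ xs) (x∉ ∷ u) {zero}  {zero}  eq = refl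
toList-injective (x ∷ xs) (x∉ ∷ u) {zero}  {suc j} eq = ⊥-elim (All.lookup x∉ (lookup∈toList xs j) eq)
toList-injective (x ∷ xs) (x∉ ∷ u) {suc i} {zero}  eq = ⊥-elim (All.lookup x∉ (lookup∈toList xs i) (sym eq))
toList-injective (x ∷ xs) (x∉ ∷ u) {suc i} {suc j} eq = cong suc (toList-injective xs u eq)

spread-flip : ∀ {m k} (ls : Vec (Fin m) k) b j c →
              flip (spread ls b) (V.lookup ls j) c ≡ spread ls (flip b j c)
spread-flip (l ∷ ls) (b ∷ bs) zero    c = flip-flip (spread ls bs) l b c
spread-flip (l ∷ ls) (b ∷ bs) (suc j) c with V.lookup ls j F.≟ l
... | yes eq = begin
  flip (flip S l b) (V.lookup ls j) c   ≡⟨ cong (λ i → flip (flip S l b) i c) eq ⟩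
  flip (flip S l b) l c                 ≡⟨ trans (flip-flip S l b c) (cong (flip S l) (xor-comm b c)) ⟩
  flip S l (c xor b)                    ≡⟨ flip-flip S l c b ⟨
  flip (flip S l c) l b                 ≡⟨ cong (λ i → flip (flip S i c) l b) eq ⟨
  flip (flip S (V.lookup ls j) c) l b   ≡⟨ cong (λ z → flip z l b) (spread-flip ls bs j c) ⟩
  flip (spread ls (flip bs j c)) l b    ∎
  where
  open ≡-Reasoning
  S = spread ls bs
... | no neq = trans (flip-comm (spread ls bs) b c (neq ∘ sym)) (cong (λ z → flip z l b) (spread-flip ls bs j c))

spread-surjective : ∀ {m k} (ls : Vec (Fin m) k) → Unique (V.toList ls) → ∀ x →
  (∀ {i} → i ∉ V.toList ls → V.lookup x i ≡ false) → x ≡ spread ls (V.map (V.lookup x) ls)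
spread-surjective ls u x off = lookup-ext at
  where
  b = V.map (V.lookup x) ls
  at : ∀ i → V.lookup x i ≡ V.lookup (spread ls b) i
  at i with any? (i F.≟_) (V.toList ls)
  ... | no i∉ = trans (off i∉) (sym (lookup-spread-∉ ls b i∉))
  ... | yes i∈ with ∈toList⇒lookup ls i∈
  ...   | j , refl = sym (trans (lookup-spread ls b u j) (VP.lookup-map j (V.lookup x) ls))

spread-injective : ∀ {m k} (ls : Vec (Fin m) k) → Unique (V.toList ls) → ∀ a b →
                   Agree (V.toList ls) (spread ls a) (spread ls b) → a ≡ b
spread-injective ls u a b agr = lookup-ext λ j →
  trans (sym (lookup-spread ls a u j)) (trans (agr (lookup∈toList ls j)) (lookup-spread ls b u j))

takeVec : ∀ {A : Set} k (xs : List A) → k ≤ length xs → Vec A k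
takeVec zero    xs       _        = []
takeVec (suc k) (x ∷ xs) (s≤s le) = x ∷ takeVec k xs le

toList-takeVec : ∀ {A : Set} k (xs : List A) (le : k ≤ length xs) → V.toList (takeVec k xs le) ≡ take k xs
toList-takeVec zero    xs       _        = refl
toList-takeVec (suc k) (x ∷ xs) (s≤s le) = cong (x ∷_) (toList-takeVec k xs le)

∈-take⁻ : ∀ {A : Set} k (xs : List A) {x} → x ∈ take k xs → x ∈ xs
∈-take⁻ (suc k) (x ∷ xs) (here eq)  = here eq
∈-take⁻ (suc k) (x ∷ xs) (there x∈) = there (∈-take⁻ k xs x∈)

length-toList : ∀ {A : Set} {k} (xs : Vec A k) → length (V.toList xs) ≡ k
length-toList []       = refl
length-toList (x ∷ xs) = cong suc (length-toList xs)

-- Many disjoint transpositions at once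

opaque
  swapCost : ℕ → ℕ → ℕ
  swapCost m k = 12 * m + 8 + 2 * (2 ^ k * (k * (10 * 2 ^ (2 ^ k) + 8)) + 2 ^ k * (2 ^ (2 ^ k) * (10 * k + 8)))

-- The points p b are brought to standard position: lines with repeated columns are cleared by CNOTs
-- from representatives R, the index b is written on k cleared lines ℓ by table lookup from R, and R is
-- erased by table lookup from ℓ. There the swap is one NOT controlled by all lines outside ℓ, with a
-- borrowed line taken from ℓ.
module SimultaneousSwap {m k : ℕ} (p : Bits k → Bits m)
  (p-injective : ∀ {a b} → p a ≡ p b → a ≡ b)
  (enough : 2 ^ (2 ^ k) + suc k ≤ m)
  (j₀ j₁ : Fin k) (j₁≢j₀ : j₁ ≢ j₀) where

  column : Fin m → Bits (2 ^ k)
  column i = V.tabulate λ a → V.lookup (p (fromFin a)) i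

  column-≡ : ∀ {i j} → column i ≡ column j → ∀ b → V.lookup (p b) i ≡ V.lookup (p b) j
  column-≡ {i} {j} eq b = subst (λ b → V.lookup (p b) i ≡ V.lookup (p b) j) (fromFin∘toFin b)
    (trans (sym (VP.lookup∘tabulate _ (toFin b)))
      (trans (cong (λ c → V.lookup c (toFin b)) eq) (VP.lookup∘tabulate _ (toFin b))))

  reps : ∃ λ rs → Unique (map column rs) × (∀ {i} → i ∈ allFin m → ∃ λ r → r ∈ rs × column r ≡ column i)
  reps = representatives _≟ᵇ_ column (allFin m)

  R : List (Fin m)
  R = proj₁ reps

  R-unique : Unique R
  R-unique = UP.map⁻ (proj₁ (proj₂ reps))

  rep : Fin m → Fin m
  rep i = proj₁ (proj₂ (proj₂ reps) (∈-allFin i))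

  rep∈R : ∀ i → rep i ∈ R
  rep∈R i = proj₁ (proj₂ (proj₂ (proj₂ reps) (∈-allFin i)))

  rep-≡ : ∀ i b → V.lookup (p b) (rep i) ≡ V.lookup (p b) i
  rep-≡ i = column-≡ (proj₂ (proj₂ (proj₂ (proj₂ reps) (∈-allFin i))))

  length-R : length R ≤ 2 ^ (2 ^ k)
  length-R = begin
    length R                   ≡⟨ length-map column R ⟨
    length (map column R)      ≤⟨ Unique-⊆⇒length≤ (proj₁ (proj₂ reps)) (λ {x} _ → ∈-allBits x) ⟩
    length (allBits (2 ^ k))   ≡⟨ length-allBits (2 ^ k) ⟩
    2 ^ (2 ^ k)                ∎
    where open ≤-Reasoning

  ∉R? : ∀ i → Dec (i ∉ R)
  ∉R? i = ¬? (any? (i F.≟_) R)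

  N : List (Fin m)
  N = filter ∉R? (allFin m)

  N-unique : Unique N
  N-unique = UP.filter⁺ ∉R? (UP.allFin⁺ m)

  ∈N⇒∉R : ∀ {i} → i ∈ N → i ∉ R
  ∈N⇒∉R = proj₂ ∘ ∈-filter⁻ ∉R? {xs = allFin m}

  ∉R⇒∈N : ∀ {i} → i ∉ R → i ∈ N
  ∉R⇒∈N {i} = ∈-filter⁺ ∉R? (∈-allFin i)

  length≤m : ∀ {is : List (Fin m)} → Unique is → length is ≤ m
  length≤m u = ≤-trans (Unique-⊆⇒length≤ u (λ {i} _ → ∈-allFin i)) (≤-reflexive (length-tabulate {n = m} id))

  length-N : suc k ≤ length N
  length-N = +-cancelˡ-≤ (2 ^ (2 ^ k)) (suc k) (length N) (begin
    2 ^ (2 ^ k) + suc k          ≤⟨ enough ⟩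
    m                            ≡⟨ length-tabulate {n = m} id ⟨
    length (allFin m)            ≤⟨ Unique-⊆⇒length≤ (UP.allFin⁺ m) (λ {i} _ → split i (any? (i F.≟_) R)) ⟩
    length (R ++ N)              ≡⟨ length-++ R ⟩
    length R + length N          ≤⟨ +-monoˡ-≤ (length N) length-R ⟩
    2 ^ (2 ^ k) + length N       ∎)
    where
    open ≤-Reasoning
    split : ∀ i → Dec (i ∈ R) → i ∈ R ++ N
    split i (yes i∈) = ∈-++⁺ˡ i∈
    split i (no i∉)  = ∈-++⁺ʳ R (∉R⇒∈N i∉)

  zℓ : Vec (Fin m) (suc k)
  zℓ = takeVec (suc k) N length-N

  z : Fin m
  z = V.head zℓ

  ℓ : Vec (Fin m) k
  ℓ = V.tail zℓ

  β : List (Fin m)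
  β = V.toList ℓ

  zβ : z ∷ β ≡ take (suc k) N
  zβ = trans (toList-∷ zℓ) (toList-takeVec (suc k) N length-N)
    where
    toList-∷ : ∀ {n} (v : Vec (Fin m) (suc n)) → V.head v ∷ V.toList (V.tail v) ≡ V.toList v
    toList-∷ (x ∷ v) = refl

  zβ-unique : Unique (z ∷ β)
  zβ-unique = subst Unique (sym zβ) (UP.take⁺ (suc k) N-unique)

  β-unique : Unique β
  β-unique with _ ∷ u ← zβ-unique = u

  z∉β : z ∉ β
  z∉β z∈ with z∉ ∷ _ ← zβ-unique = All.lookup z∉ z∈ refl

  ∈zβ⇒∈N : ∀ {i} → i ∈ z ∷ β → i ∈ N
  ∈zβ⇒∈N i∈ = ∈-take⁻ (suc k) N (subst (_ ∈_) zβ i∈)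

  β⊆N : ∀ {i} → i ∈ β → i ∈ N
  β⊆N = ∈zβ⇒∈N ∘ there

  z∉R : z ∉ R
  z∉R = ∈N⇒∉R (∈zβ⇒∈N (here refl))

  stage₁ = copies rep N N-unique λ i r∈N → ∈N⇒∉R r∈N (rep∈R i)

  C₁ : Circuit m
  C₁ = proj₁ stage₁

  p₁ : Bits k → Bits m
  p₁ b = evalCircuit C₁ (p b)

  p₁-N : ∀ b {i} → i ∈ N → V.lookup (p₁ b) i ≡ false
  p₁-N b {i} i∈ = trans (proj₁ (proj₂ (proj₂ stage₁)) (p b) i∈)
    (trans (cong (V.lookup (p b) i xor_) (rep-≡ i b)) (xor-same (V.lookup (p b) i)))

  p₁-R : ∀ b {i} → i ∈ R → V.lookup (p₁ b) i ≡ V.lookup (p b) i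
  p₁-R b i∈ = proj₂ (proj₂ (proj₂ stage₁)) (p b) λ i∈N → ∈N⇒∉R i∈N i∈

  p₁-separated : ∀ a b → Agree R (p₁ a) (p₁ b) → a ≡ b
  p₁-separated a b agr = p-injective (lookup-ext λ i → trans (sym (rep-≡ i a))
    (trans (trans (sym (p₁-R a (rep∈R i))) (trans (agr (rep∈R i)) (p₁-R b (rep∈R i)))) (rep-≡ i b)))

  stage₂ = tableLookup R β z p₁ (spread ℓ) R-unique β-unique z∉R z∉β (∈N⇒∉R ∘ β⊆N) p₁-separated

  C₂ : Circuit m
  C₂ = proj₁ stage₂

  p₂ : Bits k → Bits m
  p₂ b = evalCircuit C₂ (p₁ b)

  p₂-β : ∀ b → Agree β (p₂ b) (spread ℓ b)
  p₂-β b {i} i∈ = trans (proj₁ (proj₂ (proj₂ stage₂) b (p₁ b) (λ _ → refl)) i∈)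
    (cong (_xor V.lookup (spread ℓ b) i) (p₁-N b (β⊆N i∈)))

  p₂-off : ∀ b {i} → i ∉ β → V.lookup (p₂ b) i ≡ V.lookup (p₁ b) i
  p₂-off b = proj₂ (proj₂ (proj₂ stage₂) b (p₁ b) (λ _ → refl))

  stage₃ = tableLookup β R z (spread ℓ) p₁ β-unique R-unique z∉β z∉R
    (λ t∈R t∈β → ∈N⇒∉R (β⊆N t∈β) t∈R) (spread-injective ℓ β-unique)

  C₃ : Circuit m
  C₃ = proj₁ stage₃

  C₁₂₃ : Circuit m
  C₁₂₃ = C₁ ++ (C₂ ++ C₃)

  normalise : ∀ b → evalCircuit C₁₂₃ (p b) ≡ spread ℓ b
  normalise b = trans (eval-++ C₁ (C₂ ++ C₃) (p b)) (trans (eval-++ C₂ C₃ (p₁ b))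
    (lookup-ext λ i → at i (any? (i F.≟_) R) (any? (i F.≟_) β)))
    where
    spec = proj₂ (proj₂ stage₃) b (p₂ b) (p₂-β b)
    at : ∀ i → Dec (i ∈ R) → Dec (i ∈ β) → V.lookup (evalCircuit C₃ (p₂ b)) i ≡ V.lookup (spread ℓ b) i
    at i (yes i∈R) _ = trans (proj₁ spec i∈R)
      (trans (cong (_xor V.lookup (p₁ b) i) (p₂-off b i∉β))
        (trans (xor-same (V.lookup (p₁ b) i)) (sym (lookup-spread-∉ ℓ b i∉β))))
      where
      i∉β : i ∉ β
      i∉β i∈ = ∈N⇒∉R (β⊆N i∈) i∈R
    at i (no i∉R) (yes i∈β) = trans (proj₂ spec i∉R) (p₂-β b i∈β)
    at i (no i∉R) (no i∉β) = trans (proj₂ spec i∉R)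
      (trans (p₂-off b i∉β) (trans (p₁-N b (∉R⇒∈N i∉R)) (sym (lookup-spread-∉ ℓ b i∉β))))

  ℓ₀ ℓ₁ : Fin m
  ℓ₀ = V.lookup ℓ j₀
  ℓ₁ = V.lookup ℓ j₁

  ∉β? : ∀ i → Dec (i ∉ β)
  ∉β? i = ¬? (any? (i F.≟_) β)

  O : List (Fin m)
  O = filter ∉β? (allFin m)

  O-unique : Unique O
  O-unique = UP.filter⁺ ∉β? (UP.allFin⁺ m)

  ∈O⇒∉β : ∀ {i} → i ∈ O → i ∉ β
  ∈O⇒∉β = proj₂ ∘ ∈-filter⁻ ∉β? {xs = allFin m}

  ℓ₀∈β : ℓ₀ ∈ β
  ℓ₀∈β = lookup∈toList ℓ j₀

  ℓ₁∈β : ℓ₁ ∈ β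
  ℓ₁∈β = lookup∈toList ℓ j₁

  ℓ₁≢ℓ₀ : ℓ₁ ≢ ℓ₀
  ℓ₁≢ℓ₀ = j₁≢j₀ ∘ toList-injective ℓ β-unique

  zeros : Bits m
  zeros = V.replicate m false

  core = controlled-match O zeros ℓ₀ ℓ₁ O-unique (λ ∈O → ∈O⇒∉β ∈O ℓ₀∈β) (λ ∈O → ∈O⇒∉β ∈O ℓ₁∈β) ℓ₁≢ℓ₀

  C₄ : Circuit m
  C₄ = proj₁ core

  core-spread : ∀ b → evalCircuit C₄ (spread ℓ b) ≡ spread ℓ (flip b j₀ true)
  core-spread b = trans (proj₂ (proj₂ core) (spread ℓ b))
    (trans (cong (flip (spread ℓ b) ℓ₀) matches) (spread-flip ℓ b j₀ true))
    where
    matches = match-true O zeros (spread ℓ b) λ {i} i∈ →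
      trans (lookup-spread-∉ ℓ b (∈O⇒∉β i∈)) (sym (VP.lookup-replicate i false))

  core-other : ∀ x → (∀ b → x ≢ spread ℓ b) → evalCircuit C₄ x ≡ x
  core-other x x≢ with match O zeros x in eq
  ... | false = trans (proj₂ (proj₂ core) x) (trans (cong (flip x ℓ₀) eq) (flip-false x ℓ₀))
  ... | true  = ⊥-elim (x≢ _ (spread-surjective ℓ β-unique x λ {i} i∉ →
    trans (match-true⁻ O zeros x eq (∈-filter⁺ ∉β? (∈-allFin i) i∉)) (VP.lookup-replicate i false)))

  circuit : Circuit m
  circuit = C₁₂₃ ++ (C₄ ++ inv C₁₂₃)

  eval-circuit : ∀ x → evalCircuit circuit x ≡ evalCircuit (inv C₁₂₃) (evalCircuit C₄ (evalCircuit C₁₂₃ x))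
  eval-circuit x = trans (eval-++ C₁₂₃ (C₄ ++ inv C₁₂₃) x) (eval-++ C₄ (inv C₁₂₃) _)

  circuit-swaps : ∀ b → evalCircuit circuit (p b) ≡ p (flip b j₀ true)
  circuit-swaps b = begin
    evalCircuit circuit (p b)                                          ≡⟨ eval-circuit _ ⟩
    evalCircuit (inv C₁₂₃) (evalCircuit C₄ (evalCircuit C₁₂₃ (p b)))   ≡⟨ cong (evalCircuit (inv C₁₂₃) ∘ evalCircuit C₄) (normalise b) ⟩
    evalCircuit (inv C₁₂₃) (evalCircuit C₄ (spread ℓ b))               ≡⟨ cong (evalCircuit (inv C₁₂₃)) (core-spread b) ⟩
    evalCircuit (inv C₁₂₃) (spread ℓ (flip b j₀ true))                 ≡⟨ cong (evalCircuit (inv C₁₂₃)) (normalise (flip b j₀ true)) ⟨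
    evalCircuit (inv C₁₂₃) (evalCircuit C₁₂₃ (p (flip b j₀ true)))     ≡⟨ inv-eval C₁₂₃ _ ⟩
    p (flip b j₀ true)                                                 ∎
    where open ≡-Reasoning

  circuit-fixes : ∀ x → (∀ b → x ≢ p b) → evalCircuit circuit x ≡ x
  circuit-fixes x x≢ = trans (eval-circuit x) (trans (cong (evalCircuit (inv C₁₂₃)) (core-other _ λ b eq →
      x≢ b (eval-injective C₁₂₃ (trans eq (sym (normalise b)))))) (inv-eval C₁₂₃ x))

  opaque
    unfolding swapCost

    length-circuit : length circuit ≤ swapCost m k
    length-circuit = begin
      length circuit                                        ≡⟨ trans (length-++ C₁₂₃) (cong (length C₁₂₃ +_) (trans (length-++ C₄) (cong (length C₄ +_) (length-inv C₁₂₃)))) ⟩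
      length C₁₂₃ + (length C₄ + length C₁₂₃)               ≤⟨ +-mono-≤ len₁₂₃ (+-mono-≤ len₄ len₁₂₃) ⟩
      (m + (X + Y)) + ((10 * m + 8) + (m + (X + Y)))        ≡⟨ arith m X Y ⟩
      12 * m + 8 + 2 * (X + Y)                              ∎
      where
      open ≤-Reasoning
      X Y : ℕ
      X = 2 ^ k * (k * (10 * 2 ^ (2 ^ k) + 8))
      Y = 2 ^ k * (2 ^ (2 ^ k) * (10 * k + 8))
      arith : ∀ m X Y → (m + (X + Y)) + ((10 * m + 8) + (m + (X + Y))) ≡ 12 * m + 8 + 2 * (X + Y)
      arith = solve-∀
      len₂ : length C₂ ≤ X
      len₂ = ≤-trans (proj₁ (proj₂ stage₂)) (*-monoʳ-≤ (2 ^ k) (*-mono-≤ (≤-reflexive (length-toList ℓ)) (+-monoˡ-≤ 8 (*-monoʳ-≤ 10 length-R))))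
      len₃ : length C₃ ≤ Y
      len₃ = ≤-trans (proj₁ (proj₂ stage₃)) (*-monoʳ-≤ (2 ^ k) (*-mono-≤ length-R (≤-reflexive (cong (λ l → 10 * l + 8) (length-toList ℓ)))))
      len₁₂₃ : length C₁₂₃ ≤ m + (X + Y)
      len₁₂₃ = ≤-trans (≤-reflexive (trans (length-++ C₁) (cong (length C₁ +_) (length-++ C₂))))
        (+-mono-≤ (≤-trans (proj₁ (proj₂ stage₁)) (length≤m N-unique)) (+-mono-≤ len₂ len₃))
      len₄ : length C₄ ≤ 10 * m + 8
      len₄ = ≤-trans (proj₁ (proj₂ core)) (+-monoˡ-≤ 8 (*-monoʳ-≤ 10 (length≤m O-unique)))

opaque
  simultaneousSwap : ∀ {m j} → 1 ≤ j → 2 ^ (2 ^ suc j) + suc (suc j) ≤ m →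
    (p : Bits (suc j) → Bits m) → (∀ {a b} → p a ≡ p b → a ≡ b) →
    ∃ λ C → length C ≤ swapCost m (suc j) ×
      (∀ b bs → evalCircuit C (p (b ∷ bs)) ≡ p ((b xor true) ∷ bs)) ×
      (∀ x → (∀ b → x ≢ p b) → evalCircuit C x ≡ x)
  simultaneousSwap {j = suc _} _ enough p inj =
    circuit , length-circuit , (λ b bs → circuit-swaps (b ∷ bs)) , circuit-fixes
    where open SimultaneousSwap p inj enough zero (suc zero) (λ ())

-- Parity

Unique-resp-↭ : ∀ {A : Set} {xs ys : List A} → xs ↭ ys → Unique xs → Unique ys
Unique-resp-↭ {A} p = PermS.Unique-resp-↭ (setoid A) (Perm.↭⇒↭ₛ p)

lt : ∀ {n} → Bits n → Bits n → Bool
lt []          []          = false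
lt (false ∷ x) (false ∷ y) = lt x y
lt (false ∷ x) (true  ∷ y) = true
lt (true  ∷ x) (false ∷ y) = false
lt (true  ∷ x) (true  ∷ y) = lt x y

lt-total : ∀ {n} (x y : Bits n) → x ≢ y → lt x y xor lt y x ≡ true
lt-total []          []          x≢y = ⊥-elim (x≢y refl)
lt-total (false ∷ x) (false ∷ y) x≢y = lt-total x y (x≢y ∘ cong (false ∷_))
lt-total (false ∷ x) (true  ∷ y) x≢y = refl
lt-total (true  ∷ x) (false ∷ y) x≢y = refl
lt-total (true  ∷ x) (true  ∷ y) x≢y = lt-total x y (x≢y ∘ cong (true ∷_))

below : ∀ {n} → Bits n → List (Bits n) → Bool
below x []      = false
below x (y ∷ l) = lt y x xor below x l

inversionParity : ∀ {n} → List (Bits n) → Bool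
inversionParity []      = false
inversionParity (x ∷ l) = below x l xor inversionParity l

xor-swap : ∀ a b c → a xor (b xor c) ≡ b xor (a xor c)
xor-swap a b c = trans (sym (xor-assoc a b c)) (trans (cong (_xor c) (xor-comm a b)) (xor-assoc b a c))

xor-interchange : ∀ a b c d → (a xor b) xor (c xor d) ≡ (a xor c) xor (b xor d)
xor-interchange a b c d = begin
  (a xor b) xor (c xor d)  ≡⟨ xor-assoc a b (c xor d) ⟩
  a xor (b xor (c xor d))  ≡⟨ cong (a xor_) (xor-swap b c d) ⟩
  a xor (c xor (b xor d))  ≡⟨ xor-assoc a c (b xor d) ⟨
  (a xor c) xor (b xor d)  ∎
  where open ≡-Reasoning

below-↭ : ∀ {n} (x : Bits n) {l l′} → l ↭ l′ → below x l ≡ below x l′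
below-↭ x Perm.refl         = refl
below-↭ x (prep y p)        = cong (lt y x xor_) (below-↭ x p)
below-↭ x (swap y z p)      = trans (xor-swap (lt y x) (lt z x) _)
  (cong (λ b → lt z x xor (lt y x xor b)) (below-↭ x p))
below-↭ x (Perm.trans p p′) = trans (below-↭ x p) (below-↭ x p′)

inversionParity-swap : ∀ {n} {x y : Bits n} l → x ≢ y →
                       inversionParity (x ∷ y ∷ l) ≡ true xor inversionParity (y ∷ x ∷ l)
inversionParity-swap {x = x} {y} l x≢y = begin
  (lt y x xor below x l) xor (below y l xor q)  ≡⟨ cong (λ b → (b xor below x l) xor (below y l xor q)) ltyx ⟩
  ((true xor lt x y) xor below x l) xor (below y l xor q)
    ≡⟨ lemma (lt x y) (below x l) (below y l) q ⟩
  true xor ((lt x y xor below y l) xor (below x l xor q)) ∎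
  where
  open ≡-Reasoning
  q = inversionParity l
  ltyx : lt y x ≡ true xor lt x y
  ltyx with lt x y | lt y x | lt-total x y x≢y
  ... | false | true  | _ = refl
  ... | true  | false | _ = refl
  lemma : ∀ a b c d → ((true xor a) xor b) xor (c xor d) ≡ true xor ((a xor c) xor (b xor d))
  lemma a b c d = begin
    ((true xor a) xor b) xor (c xor d)   ≡⟨ cong (_xor (c xor d)) (xor-assoc true a b) ⟩
    (true xor (a xor b)) xor (c xor d)   ≡⟨ xor-assoc true (a xor b) (c xor d) ⟩
    true xor ((a xor b) xor (c xor d))   ≡⟨ cong (true xor_) (xor-interchange a b c d) ⟩
    true xor ((a xor c) xor (b xor d))   ∎

parityChange : ∀ {n} → (Bits n → Bits n) → List (Bits n) → Bool
parityChange g l = inversionParity l xor inversionParity (map g l)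

parityChange-∷ : ∀ {n} (g : Bits n → Bits n) x {l l′} → l ↭ l′ → parityChange g l ≡ parityChange g l′ →
                 parityChange g (x ∷ l) ≡ parityChange g (x ∷ l′)
parityChange-∷ g x {l} {l′} p eq = begin
  (below x l xor inversionParity l) xor (below (g x) (map g l) xor inversionParity (map g l))
    ≡⟨ xor-interchange (below x l) _ _ _ ⟩
  (below x l xor below (g x) (map g l)) xor parityChange g l
    ≡⟨ cong₂ _xor_ (cong₂ _xor_ (below-↭ x p) (below-↭ (g x) (PermP.map⁺ g p))) eq ⟩
  (below x l′ xor below (g x) (map g l′)) xor parityChange g l′
    ≡⟨ xor-interchange (below x l′) _ _ _ ⟩
  (below x l′ xor inversionParity l′) xor (below (g x) (map g l′) xor inversionParity (map g l′)) ∎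
  where open ≡-Reasoning

-- How g changes the inversion parity does not depend on the order in which the points are listed;
-- this makes sgn multiplicative.
parityChange-↭ : ∀ {n} (g : Bits n → Bits n) → (∀ {x y} → g x ≡ g y → x ≡ y) → ∀ {l l′} → l ↭ l′ → Unique l →
  parityChange g l ≡ parityChange g l′
parityChange-↭ g inj Perm.refl _ = refl
parityChange-↭ g inj (prep x p) (_ ∷ u) = parityChange-∷ g x p (parityChange-↭ g inj p u)
parityChange-↭ g inj (swap {l} {l′} x y p) ((x≢y ∷ _) ∷ _ ∷ ul) = begin
  inversionParity (x ∷ y ∷ l) xor inversionParity (map g (x ∷ y ∷ l))
    ≡⟨ cong₂ _xor_ (inversionParity-swap l x≢y) (inversionParity-swap (map g l) (x≢y ∘ inj)) ⟩
  (true xor inversionParity (y ∷ x ∷ l)) xor (true xor inversionParity (map g (y ∷ x ∷ l)))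
    ≡⟨ xor-interchange true (inversionParity (y ∷ x ∷ l)) true (inversionParity (map g (y ∷ x ∷ l))) ⟩
  parityChange g (y ∷ x ∷ l)
    ≡⟨ parityChange-∷ g y (prep x p) (parityChange-∷ g x p (parityChange-↭ g inj p ul)) ⟩
  parityChange g (y ∷ x ∷ l′) ∎
  where open ≡-Reasoning
parityChange-↭ g inj (Perm.trans p p′) u =
  trans (parityChange-↭ g inj p u) (parityChange-↭ g inj p′ (Unique-resp-↭ p u))

sgn : ∀ {n} → (Bits n → Bits n) → Bool
sgn {n} g = parityChange g (allBits n)

sgn-cong : ∀ {n} {g h : Bits n → Bits n} → (∀ x → g x ≡ h x) → sgn g ≡ sgn h
sgn-cong {n} eq = cong (λ l → inversionParity (allBits n) xor inversionParity l) (map-cong eq (allBits n))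

sgn-id : ∀ {n} → sgn {n} id ≡ false
sgn-id {n} = trans (cong (λ l → inversionParity (allBits n) xor inversionParity l) (map-id (allBits n)))
  (xor-same (inversionParity (allBits n)))

sgn-∘ : ∀ {n} (g h h⁻¹ : Bits n → Bits n) → (∀ {x y} → g x ≡ g y → x ≡ y) →
        (∀ x → h⁻¹ (h x) ≡ x) → (∀ x → h (h⁻¹ x) ≡ x) → sgn (g ∘ h) ≡ sgn g xor sgn h
sgn-∘ {n} g h h⁻¹ inj left right = sym (begin
  (P xor inversionParity (map g L)) xor (P xor inversionParity (map h L))
    ≡⟨ cong (_xor (P xor inversionParity (map h L))) (parityChange-↭ g inj hL↭L hL-unique) ⟨
  (inversionParity (map h L) xor inversionParity (map g (map h L))) xor (P xor inversionParity (map h L))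
    ≡⟨ telescope (inversionParity (map h L)) _ P ⟩
  P xor inversionParity (map g (map h L))
    ≡⟨ cong (λ l → P xor inversionParity l) (map-∘ L) ⟨
  P xor inversionParity (map (g ∘ h) L) ∎)
  where
  open ≡-Reasoning
  L = allBits n
  P = inversionParity L
  hL-unique : Unique (map h L)
  hL-unique = UP.map⁺ (λ {x} {y} eq → trans (sym (left x)) (trans (cong h⁻¹ eq) (left y))) (allBits-unique n)
  hL↭L : map h L ↭ L
  hL↭L = ∼bag⇒↭ (unique∧set⇒bag hL-unique (allBits-unique n)
    (λ {x} → mk⇔ (λ _ → ∈-allBits x) (λ _ → subst (_∈ map h L) (right x) (∈-map⁺ h (∈-allBits (h⁻¹ x))))))
  telescope : ∀ a b c → (a xor b) xor (c xor a) ≡ c xor b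
  telescope a b c = begin
    (a xor b) xor (c xor a)  ≡⟨ cong ((a xor b) xor_) (xor-comm c a) ⟩
    (a xor b) xor (a xor c)  ≡⟨ xor-interchange a b a c ⟩
    (a xor a) xor (b xor c)  ≡⟨ cong (_xor (b xor c)) (xor-same a) ⟩
    b xor c                  ≡⟨ xor-comm b c ⟩
    c xor b                  ∎

sgn-transposition : ∀ {n} (τ : Bits n → Bits n) a b → a ≢ b → (∀ {x y} → τ x ≡ τ y → x ≡ y) →
  τ a ≡ b → τ b ≡ a → (∀ x → x ≢ a → x ≢ b → τ x ≡ x) → sgn τ ≡ true
sgn-transposition {n} τ a b a≢b inj τa τb fixes with ∈-∃++ (∈-allBits a)
... | as , bs , eq = go (∈-∃++ b∈)
  where
  open ≡-Reasoning
  b∈ : b ∈ as ++ bs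
  b∈ with ∈-++⁻ as (subst (b ∈_) eq (∈-allBits b))
  ... | inj₁ b∈as         = ∈-++⁺ˡ b∈as
  ... | inj₂ (here b≡a)   = ⊥-elim (a≢b (sym b≡a))
  ... | inj₂ (there b∈bs) = ∈-++⁺ʳ as b∈bs
  go : (∃ λ cs → ∃ λ ds → as ++ bs ≡ cs ++ b ∷ ds) → sgn τ ≡ true
  go (cs , ds , eq′) = begin
    sgn τ                                                           ≡⟨ parityChange-↭ τ inj L↭l (allBits-unique n) ⟩
    inversionParity (a ∷ b ∷ r) xor inversionParity (τ a ∷ τ b ∷ map τ r)
      ≡⟨ cong (λ l → inversionParity (a ∷ b ∷ r) xor inversionParity l) (cong₂ _∷_ τa (cong₂ _∷_ τb τr)) ⟩
    inversionParity (a ∷ b ∷ r) xor inversionParity (b ∷ a ∷ r)     ≡⟨ cong (_xor inversionParity (b ∷ a ∷ r)) (inversionParity-swap r a≢b) ⟩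
    (true xor inversionParity (b ∷ a ∷ r)) xor inversionParity (b ∷ a ∷ r)  ≡⟨ xor-cancel true (inversionParity (b ∷ a ∷ r)) ⟩
    true                                                            ∎
    where
    r = cs ++ ds
    L↭l : allBits n ↭ a ∷ b ∷ r
    L↭l = ↭-trans (Perm.↭-reflexive eq) (↭-trans (PermP.shift a as bs)
      (prep a (↭-trans (Perm.↭-reflexive eq′) (PermP.shift b cs ds))))
    τr : map τ r ≡ r
    τr with (_ ∷ a∉) ∷ b∉ ∷ _ ← Unique-resp-↭ L↭l (allBits-unique n) =
      map-id-local (All.tabulate λ {x} x∈ → fixes x (λ x≡a → All.lookup a∉ x∈ (sym x≡a)) (λ x≡b → All.lookup b∉ x∈ (sym x≡b)))

involution-injective : ∀ {A : Set} (g : A → A) → (∀ x → g (g x) ≡ x) → ∀ {x y} → g x ≡ g y → x ≡ y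
involution-injective g ii {x} {y} eq = trans (sym (ii x)) (trans (cong g eq) (ii y))

-- A line u not touched by g exhibits g as γ ∘ (X γ X), where γ is g restricted to u = 0 and X negates u.
sgn-gate : ∀ {m} → 4 ≤ m → (g : Gate m) → sgn (applyGate g) ≡ false
sgn-gate {m} 4≤m g 
  with avoid F._≟_ (allFin m) (Gate.target g ∷ Gate.controls g) (UP.allFin⁺ m)
         (≤-trans (s≤s (s≤s (Gate.arity≤2 g))) (≤-trans 4≤m (≤-reflexive (sym (length-tabulate {n = m} id)))))
... | u , _ , u∉ = begin
  sgn (applyGate g)                          ≡⟨ sgn-cong factor ⟩
  sgn (γ ∘ (X ∘ (γ ∘ X)))                    ≡⟨ sgn-∘ γ (X ∘ (γ ∘ X)) (X ∘ (γ ∘ X)) γ-injective XγX² XγX² ⟩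
  sgn γ xor sgn (X ∘ (γ ∘ X))                ≡⟨ cong (sgn γ xor_) (sgn-∘ X (γ ∘ X) (X ∘ γ) X-injective (λ x → trans (cong X (γ² (X x))) (X² x)) (λ x → trans (cong γ (X² (γ x))) (γ² x))) ⟩
  sgn γ xor (sgn X xor sgn (γ ∘ X))          ≡⟨ cong (λ b → sgn γ xor (sgn X xor b)) (sgn-∘ γ X X γ-injective X² X²) ⟩
  sgn γ xor (sgn X xor (sgn γ xor sgn X))    ≡⟨ cong (sgn γ xor_) (xor-comm (sgn X) _) ⟩
  sgn γ xor ((sgn γ xor sgn X) xor sgn X)    ≡⟨ cong (sgn γ xor_) (xor-cancel (sgn γ) (sgn X)) ⟩
  sgn γ xor sgn γ                            ≡⟨ xor-same (sgn γ) ⟩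
  false                                      ∎
  where
  open ≡-Reasoning
  u≢t : u ≢ Gate.target g
  u≢t = u∉ ∘ here
  X γ : Bits m → Bits m
  X x = flip x u true
  γ x = if V.lookup x u then x else applyGate g x
  X² : ∀ x → X (X x) ≡ x
  X² x = trans (flip-flip x u true true) (flip-false x u)
  X-injective : ∀ {x y} → X x ≡ X y → x ≡ y
  X-injective = involution-injective X X²
  keeps : ∀ x → V.lookup (applyGate g x) u ≡ V.lookup x u
  keeps x = lookup-flip-≢ x _ u≢t
  γ-on : ∀ x → V.lookup x u ≡ true → γ x ≡ x
  γ-on x eq = cong (λ b → if b then x else applyGate g x) eq
  γ-off : ∀ x → V.lookup x u ≡ false → γ x ≡ applyGate g x
  γ-off x eq = cong (λ b → if b then x else applyGate g x) eq
  γ² : ∀ x → γ (γ x) ≡ x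
  γ² x = go (V.lookup x u) refl
    where
    go : ∀ b → V.lookup x u ≡ b → γ (γ x) ≡ x
    go true  eq = trans (cong γ (γ-on x eq)) (γ-on x eq)
    go false eq = trans (cong γ (γ-off x eq))
      (trans (γ-off _ (trans (keeps x) eq)) (applyGate-involutive g x))
  γ-injective : ∀ {x y} → γ x ≡ γ y → x ≡ y
  γ-injective = involution-injective γ γ²
  XγX² : ∀ x → X (γ (X (X (γ (X x))))) ≡ x
  XγX² x = trans (cong (X ∘ γ) (X² (γ (X x)))) (trans (cong X (γ² (X x))) (X² x))
  gX : ∀ x → applyGate g (X x) ≡ X (applyGate g x)
  gX x = trans (cong (flip (X x) (Gate.target g)) (conj-flip (Gate.controls g) x u true (u∉ ∘ there)))
    (flip-comm x true _ u≢t)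
  factor : ∀ x → applyGate g x ≡ γ (X (γ (X x)))
  factor x = go (V.lookup x u) refl
    where
    go : ∀ b → V.lookup x u ≡ b → applyGate g x ≡ γ (X (γ (X x)))
    go true eq = sym (begin
      γ (X (γ (X x)))           ≡⟨ cong (γ ∘ X) (γ-off (X x) (trans (lookup-flip x u true) (cong (_xor true) eq))) ⟩
      γ (X (applyGate g (X x))) ≡⟨ cong (γ ∘ X) (gX x) ⟩
      γ (X (X (applyGate g x))) ≡⟨ cong γ (X² (applyGate g x)) ⟩
      γ (applyGate g x)         ≡⟨ γ-on _ (trans (keeps x) eq) ⟩
      applyGate g x             ∎)
    go false eq = sym (begin
      γ (X (γ (X x)))           ≡⟨ cong (γ ∘ X) (γ-on (X x) (trans (lookup-flip x u true) (cong (_xor true) eq))) ⟩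
      γ (X (X x))               ≡⟨ cong γ (X² x) ⟩
      γ x                       ≡⟨ γ-off x eq ⟩
      applyGate g x             ∎)

sgn-circuit : ∀ {m} → 4 ≤ m → (c : Circuit m) → sgn (evalCircuit c) ≡ false
sgn-circuit {m} 4≤m []  = sgn-id {m}
sgn-circuit 4≤m (g ∷ c) = trans
  (sgn-∘ (evalCircuit c) (applyGate g) (applyGate g) (eval-injective c) (applyGate-involutive g) (applyGate-involutive g))
  (cong₂ _xor_ (sgn-circuit 4≤m c) (sgn-gate 4≤m g))

-- Synthesis of injections

mismatches : ∀ {n m} → (g h : Bits n → Bits m) → List (Bits n)
mismatches {n} g h = filter (λ x → ¬? (g x ≟ᵇ h x)) (allBits n)

module _ {n m : ℕ} where

  ∈-mismatches⁻ : ∀ (g h : Bits n → Bits m) {x} → x ∈ mismatches g h → g x ≢ h x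
  ∈-mismatches⁻ g h = proj₂ ∘ ∈-filter⁻ (λ x → ¬? (g x ≟ᵇ h x)) {xs = allBits n}

  ∈-mismatches⁺ : ∀ (g h : Bits n → Bits m) {x} → g x ≢ h x → x ∈ mismatches g h
  ∈-mismatches⁺ g h {x} = ∈-filter⁺ (λ x → ¬? (g x ≟ᵇ h x)) (∈-allBits x)

  mismatches-unique : ∀ (g h : Bits n → Bits m) → Unique (mismatches g h)
  mismatches-unique g h = UP.filter⁺ (λ x → ¬? (g x ≟ᵇ h x)) (allBits-unique n)

  mismatches-[] : ∀ (g h : Bits n → Bits m) → mismatches g h ≡ [] → ∀ x → g x ≡ h x
  mismatches-[] g h eq x with g x ≟ᵇ h x
  ... | yes e = e
  ... | no ne with () ← subst (x ∈_) eq (∈-mismatches⁺ g h ne)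

  mismatches-progress : ∀ (g g′ h : Bits n → Bits m) xs → Unique xs →
    (∀ {x} → x ∈ xs → g x ≢ h x) → (∀ {x} → x ∈ xs → g′ x ≡ h x) → (∀ y → g y ≡ h y → g′ y ≡ h y) →
    length xs + length (mismatches g′ h) ≤ length (mismatches g h)
  mismatches-progress g g′ h xs u bad good keep = begin
    length xs + length (mismatches g′ h)  ≡⟨ length-++ xs ⟨
    length (xs ++ mismatches g′ h)        ≤⟨ Unique-⊆⇒length≤
      (UP.++⁺ u (mismatches-unique g′ h) λ (x∈ , x∈′) → ∈-mismatches⁻ g′ h x∈′ (good x∈))
      (λ {x} x∈ → ∈-mismatches⁺ g h (case (∈-++⁻ xs x∈))) ⟩
    length (mismatches g h)               ∎
    where
    open ≤-Reasoning
    case : ∀ {x} → x ∈ xs ⊎ x ∈ mismatches g′ h → g x ≢ h x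
    case (inj₁ x∈)     = bad x∈
    case {x} (inj₂ x∈) = ∈-mismatches⁻ g′ h x∈ ∘ keep x

length-remove : ∀ {n m} (f : Bits n → Bits m) → (∀ {x y} → f x ≡ f y → x ≡ y) → ∀ a S → Unique S →
  length S ≤ suc (length (filter (λ y → ¬? (f y ≟ᵇ a)) S))
length-remove f inj a [] u = z≤n
length-remove f inj a (y ∷ S) (y∉ ∷ u) with f y ≟ᵇ a
... | yes eq = s≤s (≤-reflexive (cong length (sym (filter-all (λ y → ¬? (f y ≟ᵇ a))
  (All.map (λ y≢z fz≡a → y≢z (inj (trans eq (sym fz≡a)))) y∉)))))
... | no  _  = s≤s (length-remove f inj a S u)

selectDisjoint : ∀ {n m} (g h : Bits n → Bits m) → (∀ {x y} → g x ≡ g y → x ≡ y) → (∀ {x y} → h x ≡ h y → x ≡ y) →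
  ∀ K (S : List (Bits n)) → Unique S → 3 * K ≤ length S →
  ∃ λ (x : Fin K → Bits n) → (∀ i → x i ∈ S) × (∀ {i i′} → i ≢ i′ → x i ≢ x i′ × g (x i) ≢ h (x i′))
selectDisjoint g h ginj hinj zero S u le = (λ ()) , (λ ()) , λ {i} → ⊥-elim (FP.¬Fin0 i)
selectDisjoint g h ginj hinj (suc K) [] u ()
selectDisjoint {n} {m} g h ginj hinj (suc K) (s ∷ S) (s∉ ∷ u) le = extend (selectDisjoint g h ginj hinj K S₂ u₂ bound)
  where
  h? : ∀ y → Dec (h y ≢ g s)
  h? y = ¬? (h y ≟ᵇ g s)
  g? : ∀ y → Dec (g y ≢ h s)
  g? y = ¬? (g y ≟ᵇ h s)
  S₁ S₂ : List (Bits n)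
  S₁ = filter h? S
  S₂ = filter g? S₁
  u₂ : Unique S₂
  u₂ = UP.filter⁺ g? (UP.filter⁺ h? u)
  bound : 3 * K ≤ length S₂
  bound = +-cancelˡ-≤ 3 (3 * K) (length S₂) (begin
    3 + 3 * K                ≡⟨ *-suc 3 K ⟨
    3 * suc K                ≤⟨ le ⟩
    suc (length S)           ≤⟨ s≤s (length-remove h hinj (g s) S u) ⟩
    2 + length S₁            ≤⟨ +-monoʳ-≤ 2 (length-remove g ginj (h s) S₁ (UP.filter⁺ h? u)) ⟩
    3 + length S₂            ∎)
    where open ≤-Reasoning
  extend : (∃ λ (x : Fin K → Bits n) → (∀ i → x i ∈ S₂) × (∀ {i i′} → i ≢ i′ → x i ≢ x i′ × g (x i) ≢ h (x i′))) →
           ∃ λ (x : Fin (suc K) → Bits n) → (∀ i → x i ∈ s ∷ S) × (∀ {i i′} → i ≢ i′ → x i ≢ x i′ × g (x i) ≢ h (x i′))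
  extend (x , x∈S₂ , disj) = x′ , x′∈ , λ {i} {i′} → disj′ i i′
    where
    x∈S₁ : ∀ i → x i ∈ S₁
    x∈S₁ i = proj₁ (∈-filter⁻ g? {xs = S₁} (x∈S₂ i))
    x∈S : ∀ i → x i ∈ S
    x∈S i = proj₁ (∈-filter⁻ h? {xs = S} (x∈S₁ i))
    x′ : Fin (suc K) → Bits n
    x′ zero    = s
    x′ (suc i) = x i
    x′∈ : ∀ i → x′ i ∈ s ∷ S
    x′∈ zero    = here refl
    x′∈ (suc i) = there (x∈S i)
    disj′ : ∀ i i′ → i ≢ i′ → x′ i ≢ x′ i′ × g (x′ i) ≢ h (x′ i′)
    disj′ zero    zero     ne = ⊥-elim (ne refl)
    disj′ zero    (suc i′) ne = All.lookup s∉ (x∈S i′) ,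
      λ eq → proj₂ (∈-filter⁻ h? {xs = S} (x∈S₁ i′)) (sym eq)
    disj′ (suc i) zero     ne = (λ eq → All.lookup s∉ (x∈S i) (sym eq)) ,
      proj₂ (∈-filter⁻ g? {xs = S₁} (x∈S₂ i))
    disj′ (suc i) (suc i′) ne = disj (ne ∘ cong suc)

opaque
  settleMany : ∀ {n m j} → 1 ≤ j → 2 ^ (2 ^ suc j) + suc (suc j) ≤ m → (g h : Bits n → Bits m) →
    (∀ {x y} → g x ≡ g y → x ≡ y) → (∀ {x y} → h x ≡ h y → x ≡ y) →
    3 * 2 ^ j ≤ length (mismatches g h) →
    ∃ λ C → length C ≤ swapCost m (suc j) ×
      2 ^ j + length (mismatches (evalCircuit C ∘ g) h) ≤ length (mismatches g h)
  settleMany {n} {m} {j} 1≤j enough g h ginj hinj many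
    with selectDisjoint g h ginj hinj (2 ^ j) (mismatches g h) (mismatches-unique g h) many
  ... | x , x∈ , disj with simultaneousSwap 1≤j enough p p-injective
    where
    bad : ∀ i → g (x i) ≢ h (x i)
    bad i = ∈-mismatches⁻ g h (x∈ i)
    p : Bits (suc j) → Bits m
    p (false ∷ b) = g (x (toFin b))
    p (true  ∷ b) = h (x (toFin b))
    x-inj : ∀ {i i′} → x i ≡ x i′ → i ≡ i′
    x-inj {i} {i′} eq = decidable-stable (i F.≟ i′) λ ne → proj₁ (disj ne) eq
    crossed : ∀ i i′ → g (x i) ≢ h (x i′)
    crossed i i′ eq with i F.≟ i′
    ... | yes refl = bad i eq
    ... | no ne    = proj₂ (disj ne) eq
    p-injective : ∀ {a b} → p a ≡ p b → a ≡ b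
    p-injective {false ∷ a} {false ∷ b} eq = cong (false ∷_) (toFin-injective (x-inj (ginj eq)))
    p-injective {false ∷ a} {true  ∷ b} eq = ⊥-elim (crossed _ _ eq)
    p-injective {true  ∷ a} {false ∷ b} eq = ⊥-elim (crossed _ _ (sym eq))
    p-injective {true  ∷ a} {true  ∷ b} eq = cong (true ∷_) (toFin-injective (x-inj (hinj eq)))
  ... | C , len , swaps , fixes = C , len , progress
    where
    settled : ∀ i → evalCircuit C (g (x i)) ≡ h (x i)
    settled i = subst (λ i → evalCircuit C (g (x i)) ≡ h (x i)) (toFin∘fromFin {j} i) (swaps false (fromFin i))
    keep : ∀ y → g y ≡ h y → evalCircuit C (g y) ≡ h y
    keep y eq = trans (fixes (g y) λ
      { (false ∷ b) e → ∈-mismatches⁻ g h (x∈ (toFin b)) (subst (λ z → g z ≡ h z) (ginj e) eq)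
      ; (true  ∷ b) e → ∈-mismatches⁻ g h (x∈ (toFin b)) (subst (λ z → g z ≡ h z) (hinj (trans (sym eq) e)) eq) }) eq
    progress : 2 ^ j + length (mismatches (evalCircuit C ∘ g) h) ≤ length (mismatches g h)
    progress = ≤-trans (+-monoˡ-≤ _ (≤-reflexive (sym (length-tabulate x))))
      (mismatches-progress g (evalCircuit C ∘ g) h (Data.List.tabulate x)
        (UP.tabulate⁺ (λ {i} {i′} eq → decidable-stable (i F.≟ i′) λ ne → proj₁ (disj ne) eq))
        (λ {y} y∈ → let i , eq = ∈-tabulate⁻ y∈ in subst (λ y → g y ≢ h y) (sym eq) (∈-mismatches⁻ g h (x∈ i)))
        (λ {y} y∈ → let i , eq = ∈-tabulate⁻ y∈ in subst (λ y → evalCircuit C (g y) ≡ h y) (sym eq) (settled i))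
        keep)

opaque
  transpose : ∀ {m} → Bits m → Bits m → Bits m → Bits m
  transpose a b x with x ≟ᵇ a | x ≟ᵇ b
  ... | yes _ | _     = b
  ... | no _  | yes _ = a
  ... | no _  | no _  = x

  transpose-ˡ : ∀ {m} (a b : Bits m) → transpose a b a ≡ b
  transpose-ˡ a b with a ≟ᵇ a | a ≟ᵇ b
  ... | yes _ | _ = refl
  ... | no a≢a | _ = ⊥-elim (a≢a refl)

  transpose-ʳ : ∀ {m} (a b : Bits m) → transpose a b b ≡ a
  transpose-ʳ a b with b ≟ᵇ a | b ≟ᵇ b
  ... | yes b≡a | _       = b≡a
  ... | no _    | yes _   = refl
  ... | no _    | no b≢b  = ⊥-elim (b≢b refl)

  transpose-other : ∀ {m} (a b : Bits m) {x} → x ≢ a → x ≢ b → transpose a b x ≡ x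
  transpose-other a b {x} x≢a x≢b with x ≟ᵇ a | x ≟ᵇ b
  ... | yes x≡a | _       = ⊥-elim (x≢a x≡a)
  ... | no _    | yes x≡b = ⊥-elim (x≢b x≡b)
  ... | no _    | no _    = refl

module _ {m : ℕ} where

  transpose-involutive : ∀ (a b x : Bits m) → transpose a b (transpose a b x) ≡ x
  transpose-involutive a b x = go (x ≟ᵇ a) (x ≟ᵇ b)
    where
    go : Dec (x ≡ a) → Dec (x ≡ b) → transpose a b (transpose a b x) ≡ x
    go (yes refl) _          = trans (cong (transpose a b) (transpose-ˡ a b)) (transpose-ʳ a b)
    go (no _)     (yes refl) = trans (cong (transpose a b) (transpose-ʳ a b)) (transpose-ˡ a b)
    go (no x≢a)   (no x≢b)   = trans (cong (transpose a b) (transpose-other a b x≢a x≢b)) (transpose-other a b x≢a x≢b)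

  transpose-injective : ∀ (a b : Bits m) {x y} → transpose a b x ≡ transpose a b y → x ≡ y
  transpose-injective a b = involution-injective (transpose a b) (transpose-involutive a b)

  transpose-avoids : ∀ (a b : Bits m) {x d} → d ≢ a → d ≢ b → x ≢ d → transpose a b x ≢ d
  transpose-avoids a b d≢a d≢b x≢d eq =
    x≢d (transpose-injective a b (trans eq (sym (transpose-other a b d≢a d≢b))))

module _ {m : ℕ} (enough : 2 ^ (2 ^ 2) + 3 ≤ m) where

  opaque
    swapTwoPairs : ∀ (a b d e : Bits m) → a ≢ b → d ≢ e → d ∉ a ∷ b ∷ [] → e ∉ a ∷ b ∷ [] →
      ∃ λ C → length C ≤ swapCost m 2 × (∀ x → evalCircuit C x ≡ transpose a b (transpose d e x))
    swapTwoPairs a b d e a≢b d≢e d∉ e∉ with simultaneousSwap (s≤s z≤n) enough p p-injective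
      where
      p : Bits 2 → Bits m
      p (false ∷ false ∷ []) = a
      p (true  ∷ false ∷ []) = b
      p (false ∷ true  ∷ []) = d
      p (true  ∷ true  ∷ []) = e
      p-injective : ∀ {u v} → p u ≡ p v → u ≡ v
      p-injective {false ∷ false ∷ []} {false ∷ false ∷ []} eq = refl
      p-injective {false ∷ false ∷ []} {true  ∷ false ∷ []} eq = ⊥-elim (a≢b eq)
      p-injective {false ∷ false ∷ []} {false ∷ true  ∷ []} eq = ⊥-elim (d∉ (here (sym eq)))
      p-injective {false ∷ false ∷ []} {true  ∷ true  ∷ []} eq = ⊥-elim (e∉ (here (sym eq)))
      p-injective {true  ∷ false ∷ []} {false ∷ false ∷ []} eq = ⊥-elim (a≢b (sym eq))
      p-injective {true  ∷ false ∷ []} {true  ∷ false ∷ []} eq = refl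
      p-injective {true  ∷ false ∷ []} {false ∷ true  ∷ []} eq = ⊥-elim (d∉ (there (here (sym eq))))
      p-injective {true  ∷ false ∷ []} {true  ∷ true  ∷ []} eq = ⊥-elim (e∉ (there (here (sym eq))))
      p-injective {false ∷ true  ∷ []} {false ∷ false ∷ []} eq = ⊥-elim (d∉ (here eq))
      p-injective {false ∷ true  ∷ []} {true  ∷ false ∷ []} eq = ⊥-elim (d∉ (there (here eq)))
      p-injective {false ∷ true  ∷ []} {false ∷ true  ∷ []} eq = refl
      p-injective {false ∷ true  ∷ []} {true  ∷ true  ∷ []} eq = ⊥-elim (d≢e eq)
      p-injective {true  ∷ true  ∷ []} {false ∷ false ∷ []} eq = ⊥-elim (e∉ (here eq))
      p-injective {true  ∷ true  ∷ []} {true  ∷ false ∷ []} eq = ⊥-elim (e∉ (there (here eq)))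
      p-injective {true  ∷ true  ∷ []} {false ∷ true  ∷ []} eq = ⊥-elim (d≢e (sym eq))
      p-injective {true  ∷ true  ∷ []} {true  ∷ true  ∷ []} eq = refl
    ... | C , len , swaps , fixes = C , len , λ x → go x (x ≟ᵇ a) (x ≟ᵇ b) (x ≟ᵇ d) (x ≟ᵇ e)
      where
      go : ∀ x → Dec (x ≡ a) → Dec (x ≡ b) → Dec (x ≡ d) → Dec (x ≡ e) →
           evalCircuit C x ≡ transpose a b (transpose d e x)
      go x (yes refl) _ _ _ = trans (swaps false (false ∷ [])) (sym
        (trans (cong (transpose x b) (transpose-other d e (λ eq → d∉ (here (sym eq))) (λ eq → e∉ (here (sym eq))))) (transpose-ˡ x b)))
      go x (no _) (yes refl) _ _ = trans (swaps true (false ∷ [])) (sym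
        (trans (cong (transpose a x) (transpose-other d e (λ eq → d∉ (there (here (sym eq)))) (λ eq → e∉ (there (here (sym eq)))))) (transpose-ʳ a x)))
      go x (no _) (no _) (yes refl) _ = trans (swaps false (true ∷ [])) (sym
        (trans (cong (transpose a b) (transpose-ˡ x e)) (transpose-other a b (e∉ ∘ here) (e∉ ∘ there ∘ here))))
      go x (no _) (no _) (no _) (yes refl) = trans (swaps true (true ∷ [])) (sym
        (trans (cong (transpose a b) (transpose-ʳ d x)) (transpose-other a b (d∉ ∘ here) (d∉ ∘ there ∘ here))))
      go x (no x≢a) (no x≢b) (no x≢d) (no x≢e) = trans
        (fixes x λ { (false ∷ false ∷ []) → x≢a ; (true ∷ false ∷ []) → x≢b ; (false ∷ true ∷ []) → x≢d ; (true ∷ true ∷ []) → x≢e })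
        (sym (trans (cong (transpose a b) (transpose-other d e x≢d x≢e)) (transpose-other a b x≢a x≢b)))

  eightPoints : 8 ≤ length (allBits m)
  eightPoints = ≤-trans (^-monoʳ-≤ 2 (≤-trans (m≤n+m 3 (2 ^ (2 ^ 2))) enough)) (≤-reflexive (sym (length-allBits m)))

  twoFresh : ∀ (ys : List (Bits m)) → length ys ≤ 4 → ∃ λ d → ∃ λ e → d ≢ e × d ∉ ys × e ∉ ys
  twoFresh ys len =
    let d , _ , d∉ = avoid _≟ᵇ_ (allBits m) ys (allBits-unique m)
                       (≤-trans (s≤s len) (≤-trans (≤ᵇ⇒≤ 5 8 _) eightPoints))
        e , _ , e∉ = avoid _≟ᵇ_ (allBits m) (d ∷ ys) (allBits-unique m)
                       (≤-trans (s≤s (s≤s len)) (≤-trans (≤ᵇ⇒≤ 6 8 _) eightPoints))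
    in d , e , (λ d≡e → e∉ (here (sym d≡e))) , d∉ , e∉ ∘ there

  -- Both transpositions are paired with one auxiliary transposition of fresh points, which cancels.
  opaque
    twoTranspositions : ∀ (a b a′ b′ : Bits m) → a ≢ b → a′ ≢ b′ →
      ∃ λ C → length C ≤ 2 * swapCost m 2 × (∀ x → evalCircuit C x ≡ transpose a′ b′ (transpose a b x))
    twoTranspositions a b a′ b′ a≢b a′≢b′ with twoFresh (a ∷ b ∷ a′ ∷ b′ ∷ []) ≤-refl
    ... | d , e , d≢e , d∉ , e∉
      with swapTwoPairs a b d e a≢b d≢e (d∉ ∘ ∈-++⁺ˡ) (e∉ ∘ ∈-++⁺ˡ)
         | swapTwoPairs a′ b′ d e a′≢b′ d≢e (d∉ ∘ ∈-++⁺ʳ (a ∷ b ∷ [])) (e∉ ∘ ∈-++⁺ʳ (a ∷ b ∷ []))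
    ... | A , lenA , specA | B , lenB , specB = A ++ B ,
      ≤-trans (≤-reflexive (length-++ A)) (+-mono-≤ lenA (≤-trans lenB (m≤m+n _ 0))) ,
      λ x → trans (eval-++ A B x) (trans (specB _) (trans (cong (transpose a′ b′ ∘ transpose d e) (specA x))
        (cong (transpose a′ b′) (cancel x (x ≟ᵇ d) (x ≟ᵇ e)))))
      where
      fix : ∀ {y} → y ∉ a ∷ b ∷ a′ ∷ b′ ∷ [] → transpose a b y ≡ y
      fix y∉ = transpose-other a b (y∉ ∘ here) (y∉ ∘ there ∘ here)
      cancel : ∀ x → Dec (x ≡ d) → Dec (x ≡ e) → transpose d e (transpose a b (transpose d e x)) ≡ transpose a b x
      cancel x (yes refl) _ = trans (cong (transpose x e) (trans (cong (transpose a b) (transpose-ˡ x e)) (fix e∉)))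
        (trans (transpose-ʳ x e) (sym (fix d∉)))
      cancel x (no _) (yes refl) = trans (cong (transpose d x) (trans (cong (transpose a b) (transpose-ʳ d x)) (fix d∉)))
        (trans (transpose-ˡ d x) (sym (fix e∉)))
      cancel x (no x≢d) (no x≢e) = trans (cong (transpose d e ∘ transpose a b) (transpose-other d e x≢d x≢e))
        (transpose-other d e (transpose-avoids a b (d∉ ∘ here) (d∉ ∘ there ∘ here) x≢d)
                             (transpose-avoids a b (e∉ ∘ here) (e∉ ∘ there ∘ here) x≢e))

mismatches-cong : ∀ {n m} {g g′ : Bits n → Bits m} (h : Bits n → Bits m) → (∀ x → g x ≡ g′ x) →
                  length (mismatches g h) ≤ length (mismatches g′ h)
mismatches-cong {g = g} {g′} h eq = Unique-⊆⇒length≤ (mismatches-unique g h) λ {x} x∈ →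
  ∈-mismatches⁺ g′ h λ e → ∈-mismatches⁻ g h x∈ (trans (eq x) e)

settleOne : ∀ {n m} (g h : Bits n → Bits m) → (∀ {x y} → g x ≡ g y → x ≡ y) → (∀ {x y} → h x ≡ h y → x ≡ y) →
  ∀ x → g x ≢ h x → suc (length (mismatches (transpose (g x) (h x) ∘ g) h)) ≤ length (mismatches g h)
settleOne g h ginj hinj x bad = mismatches-progress g (transpose (g x) (h x) ∘ g) h (x ∷ []) ([] ∷ [])
  (λ { (here refl) → bad }) (λ { (here refl) → transpose-ˡ (g x) (h x) })
  λ y eq → trans (transpose-other (g x) (h x) (λ e → bad (subst (λ z → g z ≡ h z) (ginj e) eq))
                   (λ e → bad (subst (λ z → g z ≡ h z) (hinj (trans (sym eq) e)) eq))) eq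

module Synthesis {n m : ℕ} (g₀ h : Bits n → Bits m)
  (g₀-injective : ∀ {x y} → g₀ x ≡ g₀ y → x ≡ y) (h-injective : ∀ {x y} → h x ≡ h y → x ≡ y)
  (enough : 2 ^ (2 ^ 2) + 3 ≤ m) (s : ℕ) (cost₂ : swapCost m 2 ≤ s)
  (lastTransposition : ∀ G a b → a ≢ b → (∀ x → h x ≡ transpose a b (evalCircuit G (g₀ x))) →
     ∃ λ C → length C ≤ s × (∀ x → evalCircuit C (evalCircuit G (g₀ x)) ≡ h x))
  where

  at : Circuit m → Bits n → Bits m
  at G = evalCircuit G ∘ g₀

  at-injective : ∀ G {x y} → at G x ≡ at G y → x ≡ y
  at-injective G = g₀-injective ∘ eval-injective G

  finish : ∀ M G → length (mismatches (at G) h) ≤ M →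
           ∃ λ C → length C ≤ M * s × (∀ x → evalCircuit C (at G x) ≡ h x)
  finish M G le with mismatches (at G) h in eq
  ... | [] = [] , z≤n , mismatches-[] (at G) h eq
  finish (suc M) G (s≤s le) | x ∷ _ = continue (mismatches g₁ h) refl
    where
    bad : at G x ≢ h x
    bad = ∈-mismatches⁻ (at G) h (subst (x ∈_) (sym eq) (here refl))
    g₁ : Bits n → Bits m
    g₁ = transpose (at G x) (h x) ∘ at G
    g₁-injective : ∀ {y z} → g₁ y ≡ g₁ z → y ≡ z
    g₁-injective = at-injective G ∘ transpose-injective _ _
    fewer : length (mismatches g₁ h) ≤ M
    fewer = s≤s⁻¹ (≤-trans (settleOne (at G) h (at-injective G) h-injective x bad)
      (≤-trans (≤-reflexive (cong length eq)) (s≤s le)))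
    continue : ∀ l → mismatches g₁ h ≡ l → ∃ λ C → length C ≤ suc M * s × (∀ y → evalCircuit C (at G y) ≡ h y)
    continue [] eq₁ with lastTransposition G (at G x) (h x) bad (λ y → sym (mismatches-[] g₁ h eq₁ y))
    ... | C , len , spec = C , ≤-trans len (m≤m+n s (M * s)) , spec
    continue (y ∷ _) eq₁ = second M refl
      where
      bad₁ : g₁ y ≢ h y
      bad₁ = ∈-mismatches⁻ g₁ h (subst (y ∈_) (sym eq₁) (here refl))
      second : ∀ M′ → M′ ≡ M → ∃ λ C → length C ≤ suc M * s × (∀ y → evalCircuit C (at G y) ≡ h y)
      second zero     refl with () ← subst (_≤ 0) (cong length eq₁) fewer
      second (suc M′) refl with twoTranspositions enough (at G x) (h x) (g₁ y) (h y) bad bad₁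
      ... | A , lenA , specA with finish M′ (G ++ A) fewer₂
        where
        fewer₂ : length (mismatches (at (G ++ A)) h) ≤ M′
        fewer₂ = s≤s⁻¹ (≤-trans (s≤s (mismatches-cong h λ z → trans (eval-++ G A (g₀ z)) (specA (at G z))))
          (≤-trans (settleOne g₁ h g₁-injective h-injective y bad₁) fewer))
      ... | B , lenB , specB = A ++ B , len , λ z →
        trans (eval-++ A B _) (trans (cong (evalCircuit B) (sym (eval-++ G A (g₀ z)))) (specB z))
        where
        open ≤-Reasoning
        len : length (A ++ B) ≤ suc (suc M′) * s
        len = begin
          length (A ++ B)              ≡⟨ length-++ A ⟩
          length A + length B          ≤⟨ +-mono-≤ (≤-trans lenA (*-monoʳ-≤ 2 cost₂)) lenB ⟩
          2 * s + M′ * s               ≡⟨ *-distribʳ-+ s 2 M′ ⟨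
          suc (suc M′) * s             ∎

  module _ {j : ℕ} (1≤j : 1 ≤ j) (enoughⱼ : 2 ^ (2 ^ suc j) + suc (suc j) ≤ m) (costⱼ : swapCost m (suc j) ≤ s) where

    K : ℕ
    K = 2 ^ j

    settleAll : ∀ fuel G → length (mismatches (at G) h) ≤ fuel →
      ∃ λ C → K * length C ≤ s * (length (mismatches (at G) h) + K * (3 * K)) ×
        (∀ x → evalCircuit C (at G x) ≡ h x)
    settleAll fuel G le with 3 * K ≤? length (mismatches (at G) h)
    settleAll fuel G le | no few with finish (3 * K) G (<⇒≤ (≰⇒> few))
    ... | C , len , spec = C , len′ , spec
      where
      open ≤-Reasoning
      μ = length (mismatches (at G) h)
      len′ : K * length C ≤ s * (μ + K * (3 * K))
      len′ = begin
        K * length C           ≤⟨ *-monoʳ-≤ K len ⟩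
        K * (3 * K * s)        ≡⟨ *-assoc K (3 * K) s ⟨
        K * (3 * K) * s        ≡⟨ *-comm (K * (3 * K)) s ⟩
        s * (K * (3 * K))      ≤⟨ *-monoʳ-≤ s (m≤n+m (K * (3 * K)) μ) ⟩
        s * (μ + K * (3 * K))  ∎
    settleAll zero G le | yes many =
      ⊥-elim (<⇒≱ (≤-trans (m^n>0 2 j) (m≤m+n K _)) (≤-trans many le))
    settleAll (suc fuel) G le | yes many
      with settleMany 1≤j enoughⱼ (at G) h (at-injective G) h-injective many
    ... | A , lenA , progress with settleAll fuel (G ++ A) le₂
      where
      le₂ : length (mismatches (at (G ++ A)) h) ≤ fuel
      le₂ = s≤s⁻¹ (≤-trans (s≤s (mismatches-cong h λ z → eval-++ G A (g₀ z)))
        (≤-trans (+-monoˡ-≤ _ (m^n>0 2 j)) (≤-trans progress le)))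
    ... | B , lenB , specB = A ++ B , len , λ z →
      trans (eval-++ A B _) (trans (cong (evalCircuit B) (sym (eval-++ G A (g₀ z)))) (specB z))
      where
      open ≤-Reasoning
      μ μ′ : ℕ
      μ  = length (mismatches (at G) h)
      μ′ = length (mismatches (at (G ++ A)) h)
      len : K * length (A ++ B) ≤ s * (μ + K * (3 * K))
      len = begin
        K * length (A ++ B)                    ≡⟨ trans (cong (K *_) (length-++ A)) (*-distribˡ-+ K (length A) (length B)) ⟩
        K * length A + K * length B            ≤⟨ +-mono-≤ (*-monoʳ-≤ K (≤-trans lenA costⱼ)) lenB ⟩
        K * s + s * (μ′ + K * (3 * K))         ≡⟨ cong (_+ s * (μ′ + K * (3 * K))) (*-comm K s) ⟩
        s * K + s * (μ′ + K * (3 * K))         ≡⟨ *-distribˡ-+ s K (μ′ + K * (3 * K)) ⟨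
        s * (K + (μ′ + K * (3 * K)))           ≡⟨ cong (s *_) (+-assoc K μ′ (K * (3 * K))) ⟨
        s * ((K + μ′) + K * (3 * K))           ≤⟨ *-monoʳ-≤ s (+-monoˡ-≤ (K * (3 * K))
          (≤-trans (+-monoʳ-≤ K (mismatches-cong h λ z → eval-++ G A (g₀ z))) progress)) ⟩
        s * (μ + K * (3 * K))                  ∎

    synthesis : ∃ λ C → K * length C ≤ s * (2 ^ n + K * (3 * K)) × (∀ x → evalCircuit C (g₀ x) ≡ h x)
    synthesis with settleAll (2 ^ n) [] all≤
      where
      all≤ : length (mismatches (at []) h) ≤ 2 ^ n
      all≤ = ≤-trans (length-filter (λ x → ¬? (g₀ x ≟ᵇ h x)) (allBits n)) (≤-reflexive (length-allBits n))
    ... | C , len , spec = C , ≤-trans len (*-monoʳ-≤ s (+-monoˡ-≤ (K * (3 * K))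
      (≤-trans (length-filter (λ x → ¬? (g₀ x ≟ᵇ h x)) (allBits n)) (≤-reflexive (length-allBits n))))) , spec

-- Additional inputs

φ-injective : ∀ n q {x y} → φ n q x ≡ φ n q y → x ≡ y
φ-injective n q {x} {y} = VP.++-injectiveˡ x y

ψ-++ : ∀ n q (x : Bits n) (y : Bits q) → ψ n q (x V.++ y) ≡ x
ψ-++ n q x y = VP.++-injectiveˡ (V.take n (x V.++ y)) x (VP.take++drop≡id n (x V.++ y))

φ-ψ : ∀ n (y : Bits (n + 0)) → φ n 0 (ψ n 0 y) ≡ y
φ-ψ n y = trans (cong (V.take n y V.++_) (empty (V.drop n y))) (VP.take++drop≡id n y)
  where
  empty : (v : Bits 0) → [] ≡ v
  empty [] = refl

no-odd-circuit : ∀ {m} → 4 ≤ m → (c G : Circuit m) (a b : Bits m) → a ≢ b →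
  (∀ y → evalCircuit c y ≡ transpose a b (evalCircuit G y)) → ⊥
no-odd-circuit 4≤m c G a b a≢b eq = false≢true (begin
  false                                              ≡⟨ sgn-circuit 4≤m c ⟨
  sgn (evalCircuit c)                                ≡⟨ sgn-cong eq ⟩
  sgn (transpose a b ∘ evalCircuit G)
    ≡⟨ sgn-∘ (transpose a b) (evalCircuit G) (evalCircuit (inv G)) (transpose-injective a b) (inv-eval G) (eval-inv G) ⟩
  sgn (transpose a b) xor sgn (evalCircuit G)
    ≡⟨ cong₂ _xor_ (sgn-transposition (transpose a b) a b a≢b (transpose-injective a b) (transpose-ˡ a b) (transpose-ʳ a b) (λ _ → transpose-other a b))
                   (sgn-circuit 4≤m G) ⟩
  true                                               ∎)
  where
  open ≡-Reasoning
  false≢true : false ≢ true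
  false≢true ()

module SpareLine {n q : ℕ} (G : Circuit (n + suc q)) where

  outside : Bits n → Bits (n + suc q)
  outside x = evalCircuit G (x V.++ (true ∷ V.replicate q false))

  outsidePoints : List (Bits (n + suc q))
  outsidePoints = map outside (allBits n)

  outsidePoints-unique : Unique outsidePoints
  outsidePoints-unique = UP.map⁺ (λ {x} {y} e → VP.++-injectiveˡ x y (eval-injective G e)) (allBits-unique n)

  length-outsidePoints : length outsidePoints ≡ 2 ^ n
  length-outsidePoints = trans (length-map outside (allBits n)) (length-allBits n)

  inside≢ : ∀ {z} → z ∈ outsidePoints → ∀ x → evalCircuit G (φ n (suc q) x) ≢ z
  inside≢ z∈ x refl with ∈-map⁻ outside z∈
  ... | y , _ , e with () ← cong V.head (VP.++-injectiveʳ x y (eval-injective G e))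

-- With a spare line, an odd permutation is repaired by a transposition of two points that are not
-- reached from inputs whose spare line is 0.
lastTransposition-spare : ∀ {n q} → 2 ≤ n → 2 ^ (2 ^ 2) + 3 ≤ n + suc q → (h : Bits n → Bits (n + suc q)) →
  ∀ G a b → a ≢ b → (∀ x → h x ≡ transpose a b (evalCircuit G (φ n (suc q) x))) →
  ∃ λ C → length C ≤ swapCost (n + suc q) 2 × (∀ x → evalCircuit C (evalCircuit G (φ n (suc q) x)) ≡ h x)
lastTransposition-spare {n} {q} 2≤n enough h G a b a≢b eq =
  let d , d∈ , d∉ = avoid _≟ᵇ_ outsidePoints (a ∷ b ∷ []) outsidePoints-unique (≤-trans (n≤1+n 3) four)
      e , e∈ , e∉ = avoid _≟ᵇ_ outsidePoints (d ∷ a ∷ b ∷ []) outsidePoints-unique four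
      C , len , spec = swapTwoPairs enough a b d e a≢b (λ d≡e → e∉ (here (sym d≡e))) d∉ (e∉ ∘ there)
  in C , len , λ x → trans (spec _)
       (trans (cong (transpose a b) (transpose-other d e (inside≢ d∈ x) (inside≢ e∈ x))) (sym (eq x)))
  where
  open SpareLine {n} {q} G
  four : 4 ≤ length outsidePoints
  four = ≤-trans (^-monoʳ-≤ 2 2≤n) (≤-reflexive (sym length-outsidePoints))

restrict : ∀ {m m′} → (Fin m → Fin m′) → Bits m′ → Bits m
restrict ι x = V.tabulate (V.lookup x ∘ ι)

module Relabelling {m m′ : ℕ} (ι : Fin m → Fin m′) (ι-injective : ∀ {i j} → ι i ≡ ι j → i ≡ j) where

  relabelGate : Gate m → Gate m′
  relabelGate (gate cs t u t∉ a) = gate (map ι cs) (ι t) (UP.map⁺ ι-injective u)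
    (λ t∈ → let c , c∈ , eq = ∈-map⁻ ι t∈ in t∉ (subst (_∈ cs) (sym (ι-injective eq)) c∈))
    (≤-trans (≤-reflexive (length-map ι cs)) a)

  conj-restrict : ∀ cs x → conj (map ι cs) x ≡ conj cs (restrict ι x)
  conj-restrict []       x = refl
  conj-restrict (c ∷ cs) x = cong₂ _∧_ (sym (VP.lookup∘tabulate _ c)) (conj-restrict cs x)

  restrict-gate : ∀ g x → restrict ι (applyGate (relabelGate g) x) ≡ applyGate g (restrict ι x)
  restrict-gate (gate cs t u t∉ a) x = lookup-ext λ i → trans (VP.lookup∘tabulate _ i) (at i (i F.≟ t))
    where
    at : ∀ i → Dec (i ≡ t) → V.lookup (flip x (ι t) (conj (map ι cs) x)) (ι i)
                           ≡ V.lookup (flip (restrict ι x) t (conj cs (restrict ι x))) i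
    at i (yes refl) = trans (lookup-flip x (ι i) _) (trans
      (cong₂ _xor_ (sym (VP.lookup∘tabulate _ i)) (conj-restrict cs x)) (sym (lookup-flip (restrict ι x) i _)))
    at i (no i≢t) = trans (lookup-flip-≢ x _ (i≢t ∘ ι-injective))
      (trans (sym (VP.lookup∘tabulate _ i)) (sym (lookup-flip-≢ (restrict ι x) _ i≢t)))

  relabel : Circuit m → Circuit m′
  relabel = map relabelGate

  restrict-circuit : ∀ c x → restrict ι (evalCircuit (relabel c) x) ≡ evalCircuit c (restrict ι x)
  restrict-circuit []      x = refl
  restrict-circuit (g ∷ c) x = trans (restrict-circuit c _) (cong (evalCircuit c) (restrict-gate g x))

module AddLines {n q r : ℕ} (q≤r : q ≤ r) where

  ι : Fin (n + q) → Fin (n + r)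
  ι i = F.join n r (Sum.map₂ (λ b → F.inject≤ b q≤r) (F.splitAt n i))

  ι-injective : ∀ {i j} → ι i ≡ ι j → i ≡ j
  ι-injective {i} {j} eq = trans (sym (FP.join-splitAt n q i))
    (trans (cong (F.join n q) (inner (F.splitAt n i) (F.splitAt n j)
      (trans (sym (FP.splitAt-join n r _)) (trans (cong (F.splitAt n) eq) (FP.splitAt-join n r _)))))
    (FP.join-splitAt n q j))
    where
    inner : ∀ (s t : Fin n ⊎ Fin q) → Sum.map₂ (λ b → F.inject≤ b q≤r) s ≡ Sum.map₂ (λ b → F.inject≤ b q≤r) t → s ≡ t
    inner (inj₁ a) (inj₁ b) e = cong inj₁ (SumP.inj₁-injective e)
    inner (inj₂ a) (inj₂ b) e = cong inj₂ (FP.inject≤-injective q≤r q≤r a b (SumP.inj₂-injective e))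

  open Relabelling ι ι-injective public

  ι-φ : ∀ x → restrict ι (φ n r x) ≡ φ n q x
  ι-φ x = lookup-ext λ i → trans (VP.lookup∘tabulate _ i) (trans (at (F.splitAt n i))
    (cong (V.lookup (φ n q x)) (FP.join-splitAt n q i)))
    where
    at : ∀ s → V.lookup (φ n r x) (F.join n r (Sum.map₂ (λ b → F.inject≤ b q≤r) s)) ≡ V.lookup (φ n q x) (F.join n q s)
    at (inj₁ a) = trans (VP.lookup-++ˡ x _ a) (sym (VP.lookup-++ˡ x _ a))
    at (inj₂ b) = trans (VP.lookup-++ʳ x _ (F.inject≤ b q≤r)) (trans (VP.lookup-replicate (F.inject≤ b q≤r) false)
      (sym (trans (VP.lookup-++ʳ x _ b) (VP.lookup-replicate b false))))

  ι-ψ : ∀ y → ψ n q (restrict ι y) ≡ ψ n r y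
  ι-ψ y = lookup-ext λ a → begin
    V.lookup (V.take n z) a                        ≡⟨ VP.lookup-++ˡ (V.take n z) (V.drop n z) a ⟨
    V.lookup (V.take n z V.++ V.drop n z) (a F.↑ˡ q)  ≡⟨ cong (λ v → V.lookup v (a F.↑ˡ q)) (VP.take++drop≡id n z) ⟩
    V.lookup z (a F.↑ˡ q)                          ≡⟨ VP.lookup∘tabulate _ (a F.↑ˡ q) ⟩
    V.lookup y (ι (a F.↑ˡ q))                      ≡⟨ cong (λ s → V.lookup y (F.join n r (Sum.map₂ (λ b → F.inject≤ b q≤r) s))) (FP.splitAt-↑ˡ n a q) ⟩
    V.lookup y (a F.↑ˡ r)                          ≡⟨ cong (λ v → V.lookup v (a F.↑ˡ r)) (VP.take++drop≡id n y) ⟨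
    V.lookup (V.take n y V.++ V.drop n y) (a F.↑ˡ r)  ≡⟨ VP.lookup-++ˡ (V.take n y) (V.drop n y) a ⟩
    V.lookup (V.take n y) a                        ∎
    where
    open ≡-Reasoning
    z = restrict ι y

opaque
  unfolding swapCost

  swapCost-mono : ∀ {m m′} k → m ≤ m′ → swapCost m k ≤ swapCost m′ k
  swapCost-mono k m≤ = +-monoˡ-≤ _ (+-monoˡ-≤ 8 (*-monoʳ-≤ 12 m≤))

module Upper {n j : ℕ} (1≤j : 1 ≤ j) (enough₂ : 2 ^ (2 ^ 2) + 3 ≤ n) (enoughⱼ : 2 ^ (2 ^ suc j) + suc (suc j) ≤ n)
  (s : ℕ) (cost₂ : swapCost (n + n) 2 ≤ s) (costⱼ : swapCost (n + n) (suc j) ≤ s) where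

  Short : ∀ {m} → Circuit m → Set
  Short C = 2 ^ j * length C ≤ s * (2 ^ n + 2 ^ j * (3 * 2 ^ j))

  2≤n : 2 ≤ n
  2≤n = ≤-trans (≤-trans (n≤1+n 2) (m≤n+m 3 (2 ^ (2 ^ 2)))) enough₂

  module _ {q : ℕ} (q≤n : q ≤ n) where

    cost₂′ : swapCost (n + q) 2 ≤ s
    cost₂′ = ≤-trans (swapCost-mono 2 (+-monoʳ-≤ n q≤n)) cost₂

    costⱼ′ : swapCost (n + q) (suc j) ≤ s
    costⱼ′ = ≤-trans (swapCost-mono (suc j) (+-monoʳ-≤ n q≤n)) costⱼ

    fewSpare : (h : Bits n → Bits (n + q)) → (∀ {x y} → h x ≡ h y → x ≡ y) →
      (∀ G a b → a ≢ b → (∀ x → h x ≡ transpose a b (evalCircuit G (φ n q x))) →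
        ∃ λ C → length C ≤ s × (∀ x → evalCircuit C (evalCircuit G (φ n q x)) ≡ h x)) →
      ∃ λ C → Short C × (∀ x → evalCircuit C (φ n q x) ≡ h x)
    fewSpare h h-injective last = synthesis 1≤j (≤-trans enoughⱼ (m≤m+n n q)) costⱼ′
      where open Synthesis (φ n q) h (φ-injective n q) h-injective (≤-trans enough₂ (m≤m+n n q)) s cost₂′ last

  withSpare : ∀ {q} → suc q ≤ n → (h : Bits n → Bits (n + suc q)) → (∀ {x y} → h x ≡ h y → x ≡ y) →
    ∃ λ C → Short C × (∀ x → evalCircuit C (φ n (suc q) x) ≡ h x)
  withSpare {q} q<n h h-injective = fewSpare q<n h h-injective λ G a b a≢b eq →
    let C , len , spec = lastTransposition-spare 2≤n (≤-trans enough₂ (m≤m+n n (suc q))) h G a b a≢b eq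
    in C , ≤-trans len (cost₂′ q<n) , spec

  shortCircuit-≤ : ∀ q → q ≤ n → ∀ f → InF n q f → ∃ λ C → Implements n q C f × Short C
  shortCircuit-≤ q q≤n f (c , impl) with target q q≤n c
    where
    target : ∀ q → q ≤ n → (c : Circuit (n + q)) →
             ∃ λ C → Short C × (∀ x → evalCircuit C (φ n q x) ≡ evalCircuit c (φ n q x))
    target zero q≤n c = fewSpare q≤n (evalCircuit c ∘ φ n 0) (φ-injective n 0 ∘ eval-injective c) λ G a b a≢b eq →
      ⊥-elim (no-odd-circuit (≤-trans (≤-trans (≤ᵇ⇒≤ 4 19 _) enough₂) (m≤m+n n 0)) c G a b a≢b λ y →
        subst (λ z → evalCircuit c z ≡ transpose a b (evalCircuit G z)) (φ-ψ n y) (eq (ψ n 0 y)))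
    target (suc q) q≤n c = withSpare q≤n (evalCircuit c ∘ φ n (suc q)) (φ-injective n (suc q) ∘ eval-injective c)
  ... | C , short , spec = C , (λ x → trans (cong (ψ n q) (spec x)) (impl x)) , short

  -- With n or more spare lines every map f is implementable, through the injection x ↦ (f x , x).
  shortCircuit-≥ : ∀ q → n ≤ q → ∀ f → ∃ λ C → Implements n q C f × Short C
  shortCircuit-≥ q n≤q f with doubled n ≤-refl 2≤n
    where
    doubled : ∀ p → p ≤ n → 2 ≤ p → (e : Bits n → Bits p) → (∀ {x y} → e x ≡ e y → x ≡ y) →
              ∃ λ C → Short C × (∀ x → evalCircuit C (φ n p x) ≡ f x V.++ e x)
    doubled (suc p) p≤n _ e e-inj = withSpare p≤n (λ x → f x V.++ e x) λ {x} {y} → e-inj ∘ VP.++-injectiveʳ (f x) (f y)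
  ... | make with make id id
  ... | C , short , spec = relabel C , impl , subst (λ l → 2 ^ j * l ≤ _) (sym (length-map relabelGate C)) short
    where
    open AddLines {n} n≤q
    impl : Implements n q (relabel C) f
    impl x = begin
      ψ n q (evalCircuit (relabel C) (φ n q x))               ≡⟨ ι-ψ _ ⟨
      ψ n n (restrict ι (evalCircuit (relabel C) (φ n q x)))  ≡⟨ cong (ψ n n) (restrict-circuit C (φ n q x)) ⟩
      ψ n n (evalCircuit C (restrict ι (φ n q x)))            ≡⟨ cong (ψ n n ∘ evalCircuit C) (ι-φ x) ⟩
      ψ n n (evalCircuit C (φ n n x))                         ≡⟨ cong (ψ n n) (spec x) ⟩
      ψ n n (f x V.++ x)                                      ≡⟨ ψ-++ n n (f x) x ⟩
      f x                                                     ∎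
      where open ≡-Reasoning

  opaque
    shortCircuit : ∀ q f → InF n q f → ∃ λ C → Implements n q C f × Short C
    shortCircuit q f inF with ≤-total q n
    ... | inj₁ q≤n = shortCircuit-≤ q q≤n f inF
    ... | inj₂ n≤q = shortCircuit-≥ q n≤q f

-- Existence of the Shannon function

controlLists : ∀ m → List (List (Fin m))
controlLists m = [] ∷ map (_∷ []) (allFin m) ++ cartesianProductWith (λ i j → i ∷ j ∷ []) (allFin m) (allFin m)

∈-controlLists : ∀ {m} (cs : List (Fin m)) → length cs ≤ 2 → cs ∈ controlLists m
∈-controlLists []              _ = here refl
∈-controlLists (i ∷ [])        _ = there (∈-++⁺ˡ (∈-map⁺ (_∷ []) (∈-allFin i)))
∈-controlLists (i ∷ j ∷ [])    _ = there (∈-++⁺ʳ (map (_∷ []) (allFin _))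
  (∈-cartesianProductWith⁺ (λ i j → i ∷ j ∷ []) (∈-allFin i) (∈-allFin j)))
∈-controlLists (_ ∷ _ ∷ _ ∷ _) (s≤s (s≤s ()))

length-cartesianProductWith : ∀ {A B C : Set} (f : A → B → C) xs ys →
  length (cartesianProductWith f xs ys) ≡ length xs * length ys
length-cartesianProductWith f []       ys = refl
length-cartesianProductWith f (x ∷ xs) ys = trans (length-++ (map (f x) ys))
  (cong₂ _+_ (length-map (f x) ys) (length-cartesianProductWith f xs ys))

length-controlLists : ∀ m → length (controlLists m) ≡ suc (m + m * m)
length-controlLists m = cong suc (trans (length-++ (map (_∷ []) (allFin m))) (cong₂ _+_
  (trans (length-map (_∷ []) (allFin m)) (length-tabulate {n = m} id))
  (trans (length-cartesianProductWith _ (allFin m) (allFin m))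
    (cong₂ _*_ (length-tabulate {n = m} id) (length-tabulate {n = m} id)))))

makeGate : ∀ {m} → List (Fin m) × Fin m → Maybe (Gate m)
makeGate (cs , t) with UniqueDec.unique? F._≟_ cs | any? (t F.≟_) cs | length cs ≤? 2
... | yes u | no t∉ | yes a = just (gate cs t u t∉ a)
... | _     | _     | _     = nothing

SameGate : ∀ {m} → Gate m → Gate m → Set
SameGate g g′ = Gate.controls g ≡ Gate.controls g′ × Gate.target g ≡ Gate.target g′

sameGate-apply : ∀ {m} {g g′ : Gate m} → SameGate g g′ → ∀ x → applyGate g x ≡ applyGate g′ x
sameGate-apply (c≡ , t≡) x = cong₂ (λ cs t → flip x t (conj cs x)) c≡ t≡

opaque
  allGates : ∀ m → List (Gate m)
  allGates m = mapMaybe makeGate (cartesianProduct (controlLists m) (allFin m))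

  length-allGates : ∀ m → length (allGates m) ≤ suc (m + m * m) * m
  length-allGates m = ≤-trans (length-mapMaybe makeGate (cartesianProduct (controlLists m) (allFin m))) (≤-reflexive
    (trans (length-cartesianProductWith _,_ (controlLists m) (allFin m))
      (cong₂ _*_ (length-controlLists m) (length-tabulate {n = m} id))))

  allGates-complete : ∀ {m} (g : Gate m) → Any (SameGate g) (allGates m)
  allGates-complete {m} g = AnyP.mapMaybe⁺ makeGate (cartesianProduct (controlLists m) (allFin m))
    (AnyP.map⁺ (Any.map (λ { refl → made }) (∈-cartesianProduct⁺ (∈-controlLists (Gate.controls g) (Gate.arity≤2 g)) (∈-allFin (Gate.target g)))))
    where
    made : MAny.Any (SameGate g) (makeGate (Gate.controls g , Gate.target g))
    made with UniqueDec.unique? F._≟_ (Gate.controls g) | any? (Gate.target g F.≟_) (Gate.controls g) | length (Gate.controls g) ≤? 2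
    ... | yes _ | no _   | yes _ = MAny.just (refl , refl)
    ... | no ¬u | _      | _     = ⊥-elim (¬u (Gate.distinct g))
    ... | yes _ | yes t∈ | _     = ⊥-elim (Gate.targetFree g t∈)
    ... | yes _ | no _   | no ¬a = ⊥-elim (¬a (Gate.arity≤2 g))

module Shannon (n q : ℕ) where

  Within : ℕ → (Bits n → Bits n) → Set
  Within k f = Σ (Circuit (n + q)) λ c → Implements n q c f × complexity c ≤ k

  Reaches : ℕ → (Bits n → Bits (n + q)) → (Bits n → Bits n) → Set
  Reaches k g f = Σ (Circuit (n + q)) λ c → (∀ x → ψ n q (evalCircuit c (g x)) ≡ f x) × complexity c ≤ k

  reaches? : ∀ k g f → Dec (Reaches k g f)
  reaches? zero    g f = map′ (λ eq → [] , eq , z≤n) (λ { ([] , eq , _) → eq }) (∀Bits? λ x → ψ n q (g x) ≟ᵇ f x)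
  reaches? (suc k) g f = map′ join split
    (∀Bits? (λ x → ψ n q (g x) ≟ᵇ f x) ⊎-dec any? (λ γ → reaches? k (applyGate γ ∘ g) f) (allGates (n + q)))
    where
    Next = λ γ → Reaches k (applyGate γ ∘ g) f
    join : (∀ x → ψ n q (g x) ≡ f x) ⊎ Any Next (allGates (n + q)) → Reaches (suc k) g f
    join (inj₁ eq)  = [] , eq , z≤n
    join (inj₂ any) = let γ , c , eq , le = Any.satisfied any in γ ∷ c , eq , s≤s le
    split : Reaches (suc k) g f → (∀ x → ψ n q (g x) ≡ f x) ⊎ Any Next (allGates (n + q))
    split ([] , eq , _)        = inj₁ eq
    split (γ ∷ c , eq , s≤s le) = inj₂ (Any.map
      (λ {γ′} same → c , (λ x → trans (cong (ψ n q ∘ evalCircuit c) (sym (sameGate-apply {g = γ} {γ′} same (g x)))) (eq x)) , le)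
      (allGates-complete γ))

  within? : ∀ k f → Dec (Within k f)
  within? k f = reaches? k (φ n q) f

  decode : Fin ((2 ^ n) ^ (2 ^ n)) → Bits n → Bits n
  decode i x = fromFin (finToFun i (toFin x))

  encode : (Bits n → Bits n) → Fin ((2 ^ n) ^ (2 ^ n))
  encode f = funToFin (toFin ∘ f ∘ fromFin)

  decode-encode : ∀ f x → decode (encode f) x ≡ f x
  decode-encode f x = trans (cong fromFin (FP.finToFun-funToFin (toFin ∘ f ∘ fromFin) (toFin x)))
    (trans (fromFin∘toFin _) (cong f (fromFin∘toFin x)))

  within-cong : ∀ {k f f′} → (∀ x → f x ≡ f′ x) → Within k f → Within k f′
  within-cong eq (c , impl , le) = c , (λ x → trans (impl x) (eq x)) , le

  module _ (U : ℕ) (bounded : ∀ f → InF n q f → Within U f) where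

    Enough : ℕ → Set
    Enough L = ∀ f → Within U f → Within L f

    enough-or-hard : ∀ L → Enough L ⊎ (Σ (Bits n → Bits n) λ f → Within U f × ¬ Within L f)
    enough-or-hard L with FP.all? (λ i → within? U (decode i) →-dec within? L (decode i))
    ... | yes all = inj₁ λ f w → within-cong (decode-encode f)
      (all (encode f) (within-cong (sym ∘ decode-encode f) w))
    ... | no ¬all with FP.¬∀⟶∃¬ _ _ (λ i → within? U (decode i) →-dec within? L (decode i)) ¬all
    ...   | i , ¬imp = inj₂ (decode i ,
      decidable-stable (within? U (decode i)) (λ ¬w → ¬imp λ w → ⊥-elim (¬w w)) , λ w → ¬imp λ _ → w)

    least : ∀ L → Enough L → Σ ℕ λ L′ → L′ ≤ L × IsShannon n q L′
    least zero enough = 0 , z≤n , (λ f inF → enough f (bounded f inF)) ,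
      (λ x → ψ n q (φ n q x)) , ([] , λ x → refl) , λ c _ ()
    least (suc L) enough with enough-or-hard L
    ... | inj₁ enough′ = let L′ , le , sh = least L enough′ in L′ , m≤n⇒m≤1+n le , sh
    ... | inj₂ (f , (c , impl , _) , hard) = suc L , ≤-refl , (λ f inF → enough f (bounded f inF)) ,
      f , (c , impl) , λ c′ impl′ lt → hard (c′ , impl′ , s≤s⁻¹ lt)

    opaque
      exists : Σ ℕ λ L → L ≤ U × IsShannon n q L
      exists = least U λ f w → w

-- Counting

gateCode : ∀ {m} → Gate m → Fin (length (allGates m))
gateCode g = Any.index (allGates-complete g)

gateCode-injective : ∀ {m} (g g′ : Gate m) → gateCode g ≡ gateCode g′ → ∀ x → applyGate g x ≡ applyGate g′ x
gateCode-injective {m} g g′ eq x = trans (sameGate-apply {g = g} {Data.List.lookup (allGates m) (gateCode g)} (AnyP.lookup-index (allGates-complete g)) x)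
  (trans (cong (λ i → applyGate (Data.List.lookup (allGates m) i) x) eq)
    (sym (sameGate-apply {g = g′} {Data.List.lookup (allGates m) (gateCode g′)} (AnyP.lookup-index (allGates-complete g′)) x)))

circuitCode : ∀ {m} L → Circuit m → Fin (suc (length (allGates m)) ^ L)
circuitCode zero    c       = zero
circuitCode {m} (suc L) []  = combine {suc (length (allGates m))} zero (circuitCode L [])
circuitCode (suc L) (g ∷ c) = combine (suc (gateCode g)) (circuitCode L c)

circuitCode-injective : ∀ {m} L (c c′ : Circuit m) → complexity c ≤ L → complexity c′ ≤ L →
  circuitCode L c ≡ circuitCode L c′ → ∀ x → evalCircuit c x ≡ evalCircuit c′ x
circuitCode-injective zero    []      []        _ _ eq x = refl
circuitCode-injective (suc L) []      []        _ _ eq x = refl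
circuitCode-injective {m} (suc L) [] (g′ ∷ c′) _ _ eq x
  with () ← FP.combine-injectiveˡ {suc (length (allGates m))} zero (circuitCode L []) (suc (gateCode g′)) (circuitCode L c′) eq
circuitCode-injective {m} (suc L) (g ∷ c) [] _ _ eq x
  with () ← FP.combine-injectiveˡ {suc (length (allGates m))} (suc (gateCode g)) (circuitCode L c) zero (circuitCode L []) eq
circuitCode-injective (suc L) (g ∷ c) (g′ ∷ c′) (s≤s le) (s≤s le′) eq x
  with FP.combine-injective (suc (gateCode g)) (circuitCode L c) (suc (gateCode g′)) (circuitCode L c′) eq
... | g≡ , c≡ = trans (cong (evalCircuit c) (gateCode-injective g g′ (FP.suc-injective g≡) x))
  (circuitCode-injective L c c′ le le′ c≡ (applyGate g′ x))

funToFin-cong : ∀ {m n} {f g : Fin m → Fin n} → (∀ i → f i ≡ g i) → funToFin f ≡ funToFin g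
funToFin-cong {zero}  eq = refl
funToFin-cong {suc m} eq = cong₂ combine (eq zero) (funToFin-cong (eq ∘ suc))

finToFun-injective : ∀ {m n} (i j : Fin (m ^ n)) → (∀ k → finToFun {m} {n} i k ≡ finToFun j k) → i ≡ j
finToFun-injective {m} {n} i j eq = trans (sym (FP.funToFin-finToFin {n} {m} i))
  (trans (funToFin-cong {n} {m} eq) (FP.funToFin-finToFin {n} {m} j))

φ-transpose : ∀ n q (a b x : Bits n) → transpose (φ n q a) (φ n q b) (φ n q x) ≡ φ n q (transpose a b x)
φ-transpose n q a b x = go (x ≟ᵇ a) (x ≟ᵇ b)
  where
  go : Dec (x ≡ a) → Dec (x ≡ b) → transpose (φ n q a) (φ n q b) (φ n q x) ≡ φ n q (transpose a b x)
  go (yes refl) _        = trans (transpose-ˡ (φ n q x) (φ n q b)) (cong (φ n q) (sym (transpose-ˡ x b)))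
  go (no _) (yes refl)   = trans (transpose-ʳ (φ n q a) (φ n q x)) (cong (φ n q) (sym (transpose-ʳ a x)))
  go (no x≢a) (no x≢b)   = trans
    (transpose-other (φ n q a) (φ n q b) (x≢a ∘ φ-injective n q) (x≢b ∘ φ-injective n q))
    (cong (φ n q) (sym (transpose-other a b x≢a x≢b)))

module Counting (k q : ℕ) (enough : 2 ^ (2 ^ 2) + 3 ≤ suc (suc k) + q) where

  n : ℕ
  n = suc (suc k)

  exchange : Bits k → Bits k → Bits n → Bits n
  exchange i t x = transpose (false ∷ false ∷ i) (true ∷ false ∷ t)
    (transpose (false ∷ true ∷ i) (true ∷ true ∷ t) x)

  exchange-injective : ∀ i t {x y} → exchange i t x ≡ exchange i t y → x ≡ y
  exchange-injective i t = transpose-injective _ _ ∘ transpose-injective _ _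

  exchange-at : ∀ i t → exchange i t (false ∷ false ∷ i) ≡ true ∷ false ∷ t
  exchange-at i t = trans (cong (transpose _ _) (transpose-other (false ∷ true ∷ i) (true ∷ true ∷ t) (λ ()) (λ ())))
    (transpose-ˡ (false ∷ false ∷ i) (true ∷ false ∷ t))

  exchange-fixes : ∀ i t {v} → v ≢ i → exchange i t (false ∷ false ∷ v) ≡ false ∷ false ∷ v
  exchange-fixes i t v≢i = trans (cong (transpose _ _) (transpose-other (false ∷ true ∷ i) (true ∷ true ∷ t) (λ ()) (λ ())))
    (transpose-other (false ∷ false ∷ i) (true ∷ false ∷ t) (λ { refl → v≢i refl }) (λ ()))

  exchange-circuit : ∀ i t → ∃ λ C → ∀ x → evalCircuit C (φ n q x) ≡ φ n q (exchange i t x)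
  exchange-circuit i t
    with swapTwoPairs enough (φ n q (false ∷ false ∷ i)) (φ n q (true ∷ false ∷ t))
           (φ n q (false ∷ true ∷ i)) (φ n q (true ∷ true ∷ t))
           (λ ()) (λ ()) (λ { (here ()) ; (there (here ())) }) (λ { (here ()) ; (there (here ())) })
  ... | C , _ , spec = C , λ x → trans (spec (φ n q x))
    (trans (cong (transpose _ _) (φ-transpose n q (false ∷ true ∷ i) (true ∷ true ∷ t) x))
      (φ-transpose n q (false ∷ false ∷ i) (true ∷ false ∷ t) _))

  exchanges : (Bits k → Bits k) → List (Bits k) → Bits n → Bits n
  exchanges t []       x = x
  exchanges t (i ∷ is) x = exchange i (t i) (exchanges t is x)

  exchanges-circuit : ∀ t is → ∃ λ C → ∀ x → evalCircuit C (φ n q x) ≡ φ n q (exchanges t is x)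
  exchanges-circuit t []       = [] , λ x → refl
  exchanges-circuit t (i ∷ is) with exchanges-circuit t is | exchange-circuit i (t i)
  ... | C , specC | D , specD = C ++ D , λ x →
    trans (eval-++ C D _) (trans (cong (evalCircuit D) (specC x)) (specD (exchanges t is x)))

  exchanges-InF : ∀ t is → InF n q (exchanges t is)
  exchanges-InF t is with exchanges-circuit t is
  ... | C , spec = C , λ x → trans (cong (ψ n q) (spec x)) (ψ-++ n q (exchanges t is x) (V.replicate q false))

  exchanges-fixes : ∀ t is {v} → v ∉ is → exchanges t is (false ∷ false ∷ v) ≡ false ∷ false ∷ v
  exchanges-fixes t []       v∉ = refl
  exchanges-fixes t (i ∷ is) v∉ =
    trans (cong (exchange i (t i)) (exchanges-fixes t is (v∉ ∘ there))) (exchange-fixes i (t i) (v∉ ∘ here))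

  exchanges-head : ∀ t i is → All (i ≢_) is → exchanges t (i ∷ is) (false ∷ false ∷ i) ≡ true ∷ false ∷ t i
  exchanges-head t i is i∉ = trans (cong (exchange i (t i)) (exchanges-fixes t is λ i∈ → All.lookup i∉ i∈ refl))
    (exchange-at i (t i))

  -- The last exchange applied reveals t at its own index, and can then be undone.
  exchanges-injective : ∀ t t′ is → Unique is → (∀ x → exchanges t is x ≡ exchanges t′ is x) →
                        ∀ {i} → i ∈ is → t i ≡ t′ i
  exchanges-injective t t′ (j ∷ is) (j∉ ∷ u) eq = λ { (here refl) → tj ; (there i∈) → exchanges-injective t t′ is u rest i∈ }
    where
    tj : t j ≡ t′ j
    tj = cong (V.tail ∘ V.tail) (trans (sym (exchanges-head t j is j∉)) (trans (eq _) (exchanges-head t′ j is j∉)))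
    rest : ∀ x → exchanges t is x ≡ exchanges t′ is x
    rest x = exchange-injective j (t j) (trans (eq x) (cong (λ s → exchange j s (exchanges t′ is x)) (sym tj)))

  table : Fin ((2 ^ k) ^ (2 ^ k)) → Bits k → Bits k
  table c i = fromFin (finToFun c (toFin i))

  table-injective : ∀ c d → (∀ i → table c i ≡ table d i) → c ≡ d
  table-injective c d eq = finToFun-injective {2 ^ k} {2 ^ k} c d λ j →
    subst (λ j → finToFun c j ≡ finToFun d j) (toFin∘fromFin {k} j) (fromFin-injective {k} (eq (fromFin j)))

  count : ∀ L → (∀ f → InF n q f → Σ (Circuit (n + q)) λ c → Implements n q c f × complexity c ≤ L) →
          (2 ^ k) ^ (2 ^ k) ≤ suc (length (allGates (n + q))) ^ L
  count L short = FP.injective⇒≤ {f = code} λ {c} {d} → injective c d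
    where
    circuitFor : ∀ c → Σ (Circuit (n + q)) λ C → Implements n q C (exchanges (table c) (allBits k)) × complexity C ≤ L
    circuitFor c = short _ (exchanges-InF (table c) (allBits k))
    code : Fin ((2 ^ k) ^ (2 ^ k)) → Fin (suc (length (allGates (n + q))) ^ L)
    code c = circuitCode L (proj₁ (circuitFor c))
    injective : ∀ c d → code c ≡ code d → c ≡ d
    injective c d eq with circuitFor c | circuitFor d
    ... | C , implC , lenC | D , implD , lenD = table-injective c d λ i →
      exchanges-injective (table c) (table d) (allBits k) (allBits-unique k)
        (λ x → trans (sym (implC x)) (trans (cong (ψ n q) (circuitCode-injective L C D lenC lenD eq (φ n q x))) (implD x)))
        (∈-allBits i)

-- Asymptotics

n<2^n : ∀ n → n < 2 ^ n
n<2^n zero    = s≤s z≤n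
n<2^n (suc n) = begin-strict
  suc n              <⟨ s≤s (n<2^n n) ⟩
  suc (2 ^ n)        ≤⟨ +-monoˡ-≤ (2 ^ n) (m^n>0 2 n) ⟩
  2 ^ n + 2 ^ n      ≡⟨ cong (2 ^ n +_) (+-identityʳ (2 ^ n)) ⟨
  2 ^ suc n          ∎
  where open ≤-Reasoning

-- scale j = D⁴, where D = 2^(2^(j+1)) bounds the number of distinct columns for 2^j transpositions.
opaque
  scale : ℕ → ℕ
  scale j = 2 ^ (8 * 2 ^ j)

  j<scale : ∀ j → j < scale j
  j<scale j = <-trans (n<2^n j) (≤-trans (n<2^n (2 ^ j)) (^-monoʳ-≤ 2 (m≤n*m (2 ^ j) 8)))

  scale-suc : ∀ j → scale (suc j) ≡ 2 ^ (16 * 2 ^ j)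
  scale-suc j = cong (2 ^_) (arith (2 ^ j))
    where
    arith : ∀ K → 8 * (2 * K) ≡ 16 * K
    arith = solve-∀

  scale-fourth : ∀ j → let D = 2 ^ (2 ^ suc j) in scale j ≡ (D * D) * (D * D)
  scale-fourth j = begin
    2 ^ (8 * 2 ^ j)                   ≡⟨ cong (2 ^_) (arith (2 ^ j)) ⟩
    2 ^ ((P + P) + (P + P))           ≡⟨ ^-distribˡ-+-* 2 (P + P) (P + P) ⟩
    2 ^ (P + P) * 2 ^ (P + P)         ≡⟨ cong (λ d → d * d) (^-distribˡ-+-* 2 P P) ⟩
    (2 ^ P * 2 ^ P) * (2 ^ P * 2 ^ P) ∎
    where
    open ≡-Reasoning
    P : ℕ
    P = 2 ^ suc j
    arith : ∀ K → 8 * K ≡ (2 * K + 2 * K) + (2 * K + 2 * K)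
    arith = solve-∀

findScale : ∀ n → scale 1 ≤ n → ∃ λ j → 1 ≤ j × scale j ≤ n × n < scale (suc j)
findScale n s₁≤n = search n 1 (s≤s z≤n) (m≤m+n n 1) s₁≤n
  where
  search : ∀ fuel j → 1 ≤ j → n ≤ fuel + j → scale j ≤ n → ∃ λ j → 1 ≤ j × scale j ≤ n × n < scale (suc j)
  search fuel j 1≤j le sj≤n with scale (suc j) ≤? n
  ... | no  n<s = j , 1≤j , sj≤n , ≰⇒> n<s
  search zero       j 1≤j le sj≤n | yes _   = ⊥-elim (<⇒≱ (j<scale j) (≤-trans sj≤n le))
  search (suc fuel) j 1≤j le sj≤n | yes s≤n = search fuel (suc j) (s≤s z≤n) (≤-trans le (≤-reflexive (sym (+-suc fuel j)))) s≤n

opaque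
  unfolding swapCost

  swapCost-linear : ∀ n k → 1 ≤ n → let D = 2 ^ (2 ^ k) in D * (D * D) ≤ n → swapCost (n + n) k ≤ 104 * n
  swapCost-linear n k 1≤n D³≤n = begin
    12 * (n + n) + 8 + 2 * (P * (k * (10 * D + 8)) + P * (D * (10 * k + 8)))
      ≤⟨ +-monoʳ-≤ (12 * (n + n) + 8) (*-monoʳ-≤ 2 (+-mono-≤
           (*-mono-≤ P≤D (*-mono-≤ k≤D (+-monoʳ-≤ (10 * D) 8≤8D)))
           (*-mono-≤ P≤D (*-monoʳ-≤ D (+-mono-≤ (*-monoʳ-≤ 10 k≤D) 8≤8D))))) ⟩
    12 * (n + n) + 8 + 2 * (D * (D * (10 * D + 8 * D)) + D * (D * (10 * D + 8 * D)))
      ≡⟨ collect n D ⟩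
    24 * n + 8 + 72 * (D * (D * D))
      ≤⟨ +-mono-≤ (+-monoʳ-≤ (24 * n) (*-monoʳ-≤ 8 1≤n)) (*-monoʳ-≤ 72 D³≤n) ⟩
    24 * n + 8 * n + 72 * n
      ≡⟨ total n ⟩
    104 * n ∎
    where
    open ≤-Reasoning
    P D : ℕ
    P = 2 ^ k
    D = 2 ^ P
    P≤D : P ≤ D
    P≤D = <⇒≤ (n<2^n P)
    k≤D : k ≤ D
    k≤D = ≤-trans (<⇒≤ (n<2^n k)) P≤D
    8≤8D : 8 ≤ 8 * D
    8≤8D = *-monoʳ-≤ 8 (m^n>0 2 P)
    collect : ∀ n D → 12 * (n + n) + 8 + 2 * (D * (D * (10 * D + 8 * D)) + D * (D * (10 * D + 8 * D)))
                    ≡ 24 * n + 8 + 72 * (D * (D * D))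
    collect = solve-∀
    total : ∀ n → 24 * n + 8 * n + 72 * n ≡ 104 * n
    total = solve-∀

module UpperEstimate {n j : ℕ} (1≤j : 1 ≤ j) (scale≤n : scale j ≤ n) (n<scale : n < scale (suc j)) where

  K D : ℕ
  K = 2 ^ j
  D = 2 ^ (2 ^ suc j)

  D>0 : 1 ≤ D
  D>0 = m^n>0 2 (2 ^ suc j)

  1+j<D : suc j < D
  1+j<D = <-trans (n<2^n (suc j)) (n<2^n (2 ^ suc j))

  D⁴≤n : (D * D) * (D * D) ≤ n
  D⁴≤n = subst (_≤ n) (scale-fourth j) scale≤n

  D²≤n : D * D ≤ n
  D²≤n = ≤-trans (≤-trans (≤-reflexive (sym (*-identityʳ (D * D)))) (*-monoʳ-≤ (D * D) (*-mono-≤ D>0 D>0))) D⁴≤n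

  D³≤n : D * (D * D) ≤ n
  D³≤n = ≤-trans (*-monoˡ-≤ (D * D) (≤-trans (≤-reflexive (sym (*-identityʳ D))) (*-monoʳ-≤ D D>0))) D⁴≤n

  n>0 : 1 ≤ n
  n>0 = ≤-trans (*-mono-≤ D>0 D>0) D²≤n

  enoughⱼ : 2 ^ (2 ^ suc j) + suc (suc j) ≤ n
  enoughⱼ = begin
    D + suc (suc j)    ≤⟨ +-monoʳ-≤ D 1+j<D ⟩
    D + D              ≡⟨ cong (D +_) (+-identityʳ D) ⟨
    2 * D              ≤⟨ *-monoˡ-≤ D (≤-trans (s≤s (s≤s z≤n)) 1+j<D) ⟩
    D * D              ≤⟨ D²≤n ⟩
    n                  ∎
    where open ≤-Reasoning

  D₂≤D : 2 ^ (2 ^ 2) ≤ D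
  D₂≤D = ^-monoʳ-≤ 2 (^-monoʳ-≤ 2 (s≤s 1≤j))

  enough₂ : 2 ^ (2 ^ 2) + 3 ≤ n
  enough₂ = ≤-trans (+-mono-≤ D₂≤D (s≤s (s≤s 1≤j))) enoughⱼ

  open Upper 1≤j enough₂ enoughⱼ (104 * n)
    (swapCost-linear n 2 n>0 (≤-trans (*-mono-≤ D₂≤D (*-mono-≤ D₂≤D D₂≤D)) D³≤n))
    (swapCost-linear n (suc j) n>0 D³≤n)

  3K²≤2^n : K * (3 * K) ≤ 2 ^ n
  3K²≤2^n = begin
    K * (3 * K)          ≤⟨ *-monoʳ-≤ K (*-monoˡ-≤ K (n≤1+n 3)) ⟩
    K * (4 * K)          ≡⟨ arith K ⟩
    (2 * K) * (2 * K)    ≤⟨ *-mono-≤ (<⇒≤ (n<2^n (2 * K))) (<⇒≤ (n<2^n (2 * K))) ⟩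
    D * D                ≤⟨ D²≤n ⟩
    n                    ≤⟨ <⇒≤ (n<2^n n) ⟩
    2 ^ n                ∎
    where
    open ≤-Reasoning
    arith : ∀ K → K * (4 * K) ≡ (2 * K) * (2 * K)
    arith = solve-∀

  short⇒ : ∀ {m} (C : Circuit m) → Short C → K * length C ≤ 208 * (n * 2 ^ n)
  short⇒ C short = begin
    K * length C                          ≤⟨ short ⟩
    104 * n * (2 ^ n + K * (3 * K))       ≤⟨ *-monoʳ-≤ (104 * n) (+-monoʳ-≤ (2 ^ n) 3K²≤2^n) ⟩
    104 * n * (2 ^ n + 2 ^ n)             ≡⟨ arith n (2 ^ n) ⟩
    208 * (n * 2 ^ n)                     ∎
    where
    open ≤-Reasoning
    arith : ∀ n X → 104 * n * (X + X) ≡ 208 * (n * X)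
    arith = solve-∀

  shannon-exists : ∀ q → Σ ℕ (IsShannon n q)
  shannon-exists q =
    let L , _ , sh = Shannon.exists n q (208 * (n * 2 ^ n)) λ f inF →
          let C , impl , short = shortCircuit q f inF
          in C , impl , ≤-trans (≤-trans (≤-reflexive (sym (*-identityˡ (length C)))) (*-monoˡ-≤ (length C) (m^n>0 2 j))) (short⇒ C short)
    in L , sh

  upperBound : ∀ q L → IsShannon n q L → UpperBound 3328 1 n L
  upperBound q L (_ , f , inF , hard) with shortCircuit q f inF
  ... | C , impl , short = begin
    n ^ (1 * L)               ≤⟨ ^-monoˡ-≤ (1 * L) (≤-trans (<⇒≤ n<scale) (≤-reflexive (scale-suc j))) ⟩
    (2 ^ (16 * K)) ^ (1 * L)  ≡⟨ ^-*-assoc 2 (16 * K) (1 * L) ⟩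
    2 ^ (16 * K * (1 * L))    ≤⟨ ^-monoʳ-≤ 2 exponent ⟩
    2 ^ (3328 * (n * 2 ^ n))  ∎
    where
    open ≤-Reasoning
    regroup : ∀ K L → 16 * K * (1 * L) ≡ 16 * (K * L)
    regroup = solve-∀
    exponent : 16 * K * (1 * L) ≤ 3328 * (n * 2 ^ n)
    exponent = begin
      16 * K * (1 * L)            ≡⟨ regroup K L ⟩
      16 * (K * L)                ≤⟨ *-monoʳ-≤ 16 (*-monoʳ-≤ K (≮⇒≥ (hard C impl))) ⟩
      16 * (K * length C)         ≤⟨ *-monoʳ-≤ 16 (short⇒ C short) ⟩
      16 * (208 * (n * 2 ^ n))    ≡⟨ *-assoc 16 208 (n * 2 ^ n) ⟨
      3328 * (n * 2 ^ n)          ∎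

gateCount-bound : ∀ n q C → suc (suc C) ≤ n → q ≤ C * (n * n) → suc (length (allGates (n + q))) ≤ n ^ 9
gateCount-bound n q C C<n q≤ = begin
  suc (length (allGates m))                ≤⟨ s≤s (length-allGates m) ⟩
  suc (suc (m + m * m) * m)                ≤⟨ m≤m+n _ (2 * m + 2 * (m * m)) ⟩
  suc (suc (m + m * m) * m) + (2 * m + 2 * (m * m))  ≡⟨ cube m ⟩
  suc m ^ 3                                ≤⟨ ^-monoˡ-≤ 3 1+m≤n³ ⟩
  (n ^ 3) ^ 3                              ≡⟨ ^-*-assoc n 3 3 ⟩
  n ^ 9                                    ∎
  where
  open ≤-Reasoning
  m : ℕ
  m = n + q
  cube : ∀ m → suc (suc (m + m * m) * m) + (2 * m + 2 * (m * m)) ≡ suc m * (suc m * (suc m * 1))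
  cube = solve-∀
  n>0 : 1 ≤ n
  n>0 = ≤-trans (s≤s z≤n) C<n
  n≤n² : n ≤ n * n
  n≤n² = ≤-trans (≤-reflexive (sym (*-identityʳ n))) (*-monoʳ-≤ n n>0)
  gather : ∀ n C → n * n + (n * n + C * (n * n)) ≡ suc (suc C) * (n * n)
  gather = solve-∀
  third : ∀ n → n * (n * n) ≡ n * (n * (n * 1))
  third = solve-∀
  1+m≤n³ : suc m ≤ n ^ 3
  1+m≤n³ = begin
    1 + (n + q)                      ≤⟨ +-mono-≤ (≤-trans n>0 n≤n²) (+-mono-≤ n≤n² q≤) ⟩
    n * n + (n * n + C * (n * n))    ≡⟨ gather n C ⟩
    suc (suc C) * (n * n)            ≤⟨ *-monoˡ-≤ (n * n) C<n ⟩
    n * (n * n)                      ≡⟨ third n ⟩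
    n ^ 3                            ∎

lowerBound : ∀ n q C L → suc (suc C) ≤ n → q ≤ C * (n * n) → 2 ^ (2 ^ 2) + 3 ≤ n → IsShannon n q L → LowerBound 1 72 n L
lowerBound (suc zero) q C L (s≤s ()) q≤ enough sh
lowerBound n@(suc (suc k)) q C L C<n q≤ enough (short , _) = begin
  2 ^ (1 * (n * 2 ^ n))          ≤⟨ ^-monoʳ-≤ 2 exponent ⟩
  2 ^ (k * 2 ^ k * 8)            ≡⟨ ^-*-assoc 2 (k * 2 ^ k) 8 ⟨
  (2 ^ (k * 2 ^ k)) ^ 8          ≡⟨ cong (_^ 8) (^-*-assoc 2 k (2 ^ k)) ⟨
  ((2 ^ k) ^ (2 ^ k)) ^ 8        ≤⟨ ^-monoˡ-≤ 8 (Counting.count k q (≤-trans enough (m≤m+n n q)) L short) ⟩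
  (suc (length (allGates (n + q))) ^ L) ^ 8
                                 ≤⟨ ^-monoˡ-≤ 8 (^-monoˡ-≤ L (gateCount-bound n q C C<n q≤)) ⟩
  ((n ^ 9) ^ L) ^ 8              ≡⟨ cong (_^ 8) (^-*-assoc n 9 L) ⟩
  (n ^ (9 * L)) ^ 8              ≡⟨ ^-*-assoc n (9 * L) 8 ⟩
  n ^ (9 * L * 8)                ≡⟨ cong (n ^_) (regroup L) ⟩
  n ^ (72 * L)                   ∎
  where
  open ≤-Reasoning
  regroup : ∀ L → 9 * L * 8 ≡ 72 * L
  regroup = solve-∀
  quadruple : ∀ k X → 1 * (suc (suc k) * (2 * (2 * X))) ≡ (k + 2) * (4 * X)
  quadruple = solve-∀
  octuple : ∀ k X → (k + k) * (4 * X) ≡ k * X * 8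
  octuple = solve-∀
  2≤k : 2 ≤ k
  2≤k = s≤s⁻¹ (s≤s⁻¹ (≤-trans (≤ᵇ⇒≤ 4 19 _) enough))
  exponent : 1 * (n * 2 ^ n) ≤ k * 2 ^ k * 8
  exponent = begin
    1 * (n * 2 ^ n)          ≡⟨ quadruple k (2 ^ k) ⟩
    (k + 2) * (4 * 2 ^ k)    ≤⟨ *-monoˡ-≤ (4 * 2 ^ k) (+-monoʳ-≤ k 2≤k) ⟩
    (k + k) * (4 * 2 ^ k)    ≡⟨ octuple k (2 ^ k) ⟩
    k * 2 ^ k * 8            ∎

theorem2 : (q : ℕ → ℕ) → IsOn² q →
    Σ ℕ λ a₁ → Σ ℕ λ b₁ → Σ ℕ λ a₂ → Σ ℕ λ b₂ →
    1 ≤ a₁ × 1 ≤ b₁ × 1 ≤ a₂ × 1 ≤ b₂ × a₁ * b₂ ≤ a₂ * b₁ ×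
    (Σ ℕ λ N → 2 ≤ N × ∀ n → N ≤ n →
    Σ ℕ λ L → IsShannon n (q n) L × LowerBound a₁ b₁ n L × UpperBound a₂ b₂ n L)
theorem2 q (C , N₀ , q≤) =
  1 , 72 , 3328 , 1 , s≤s z≤n , s≤s z≤n , s≤s z≤n , ≤-refl , s≤s z≤n ,
  suc (suc C) + (N₀ + scale 1) , s≤s (s≤s z≤n) , bounds
  where
  bounds : ∀ n → suc (suc C) + (N₀ + scale 1) ≤ n →
           Σ ℕ λ L → IsShannon n (q n) L × LowerBound 1 72 n L × UpperBound 3328 1 n L
  bounds n N≤n with findScale n (≤-trans (≤-trans (m≤n+m (scale 1) N₀) (m≤n+m (N₀ + scale 1) (suc (suc C)))) N≤n)
  ... | j , 1≤j , scale≤n , n<scale =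
    let open UpperEstimate 1≤j scale≤n n<scale
        L , sh = shannon-exists (q n)
    in L , sh ,
       lowerBound n (q n) C L (≤-trans (m≤m+n (suc (suc C)) _) N≤n)
         (q≤ n (≤-trans (≤-trans (m≤m+n N₀ (scale 1)) (m≤n+m (N₀ + scale 1) (suc (suc C)))) N≤n)) enough₂ sh ,
       upperBound (q n) L sh
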